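{- Let $A$ be a finite alphabet, let $T$ be the shift operator on $A^\infty$, let $\mathcal{B}$ be the Borel $\sigma$-algebra of $A^\infty$, and let $\mu$ be a measure on $(A^\infty,\mathcal{B})$. Then the following two statements are equivalent: (1) for all $X,Y\in\mathcal{B}$, $\lim_{N\to\infty} N^{ -1}\sum_{k\le N-1}\mu(X\cap T^{ -k}(Y))=\mu(X)\mu(Y)$; (2) for all $x,y\in A^*$, $\lim_{N\to\infty} N^{ -1}\sum_{k\le N-1}\mu([x]\cap T^{ -k}([y]))=\mu([x])\mu([y])$.
   Context: $A^*$ is the set of finite strings over $A$, and $A^\infty$ is the set of infinite sequences over $A$. For $y\in A^*$ the cylinder $[y]$ is the set of sequences in $A^\infty$ that extend $y$; the cylinders generate the Borel $\sigma$-algebra $\mathcal{B}$. The shift $T$ deletes the first element of a sequence. The index $k$ in the sums ranges over $0,\dots,N-1$.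
   Formalization: The measure μ is taken to be finite (any total mass); for infinite-valued measures the equivalence fails, e.g. when μ(X)=∞ for every nonempty X and |A|≥2: (2) holds but (1) fails for X={aaa…}, Y={bbb…}. -}

module Defs where

open import Axiom.ExcludedMiddle using (ExcludedMiddle)
open import Data.Empty using (⊥-elim)
open import Data.Fin.Base using (Fin; zero; suc; toℕ)
open import Data.Integer.Base using (+_)
open import Data.List.Base using (List; []; _∷_; length; lookup)
open import Data.Nat.Base as ℕ using (ℕ; zero; suc)
import Data.Nat.Properties as ℕ
open import Data.Nat.GeneralisedArithmetic using (iterate)
open import Data.Product.Base using (Σ-syntax; ∃-syntax; _×_; _,_; proj₁)
open import Data.Rational.Base as ℚ using (ℚ; 0ℚ; 1ℚ; ½)
import Data.Rational.Properties as ℚ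
open import Data.Rational.Solver using (module +-*-Solver)
open import Data.Sum.Base using (_⊎_; inj₁; inj₂)
open import Function.Base using (_∘_)
open import Function.Bundles using (_↔_; Inverse)
open import Level using (0ℓ)
open import Relation.Binary.PropositionalEquality
  using (_≡_; _≢_; refl; sym; trans; cong; subst)
open import Relation.Nullary.Decidable.Core using (yes; no)
open import Relation.Unary using (Pred; ∅; _∩_; ∁; _≐_; _⊥_; _⊢_)

-- ℝ is presented by Cauchy sequences of rationals; equality of reals is _≈_,
-- not _≡_.

dist : ℚ → ℚ → ℚ
dist p q = ℚ.∣ p ℚ.- q ∣

Cauchy : (ℕ → ℚ) → Set
Cauchy x = ∀ ε → 0ℚ ℚ.< ε →
  ∃[ N ] (∀ m n → N ℕ.≤ m → N ℕ.≤ n → ℚ.∣ x m ℚ.- x n ∣ ℚ.< ε)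

record ℝ : Set where
  constructor mkℝ
  field
    seq    : ℕ → ℚ
    cauchy : Cauchy seq

open ℝ public

infix 4 _≈_ _≤_ _<_

_≈_ : ℝ → ℝ → Set
x ≈ y = ∀ ε → 0ℚ ℚ.< ε →
  ∃[ N ] (∀ n → N ℕ.≤ n → ℚ.∣ seq x n ℚ.- seq y n ∣ ℚ.< ε)

_≤_ : ℝ → ℝ → Set
x ≤ y = ∀ ε → 0ℚ ℚ.< ε →
  ∃[ N ] (∀ n → N ℕ.≤ n → seq x n ℚ.< seq y n ℚ.+ ε)

_<_ : ℝ → ℝ → Set
x < y = ∃[ ε ] (0ℚ ℚ.< ε ×
  ∃[ N ] (∀ n → N ℕ.≤ n → seq x n ℚ.+ ε ℚ.≤ seq y n))

∣p-p∣≡0 : ∀ p → dist p p ≡ 0ℚ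
∣p-p∣≡0 p = cong ℚ.∣_∣ (ℚ.+-inverseʳ p)

half-pos : ∀ {ε} → 0ℚ ℚ.< ε → 0ℚ ℚ.< ½ ℚ.* ε
half-pos 0<ε = ℚ.*-monoʳ-<-pos ½ 0<ε

half+half : ∀ ε → ½ ℚ.* ε ℚ.+ ½ ℚ.* ε ≡ ε
half+half ε = trans (sym (ℚ.*-distribʳ-+ ε ½ ½)) (ℚ.*-identityˡ ε)

∣∣-swap : ∀ p q → dist p q ≡ dist q p
∣∣-swap p q = trans (sym (ℚ.∣-p∣≡∣p∣ (p ℚ.- q)))
  (cong ℚ.∣_∣ (solve 2 (λ a b → :- (a :- b) := b :- a) refl p q))
  where open +-*-Solver

∣p∣≤∣p-q∣+∣q∣ : ∀ p q → ℚ.∣ p ∣ ℚ.≤ dist p q ℚ.+ ℚ.∣ q ∣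
∣p∣≤∣p-q∣+∣q∣ p q = subst (λ r → ℚ.∣ r ∣ ℚ.≤ dist p q ℚ.+ ℚ.∣ q ∣)
  (solve 2 (λ a b → (a :- b) :+ b := a) refl p q)
  (ℚ.∣p+q∣≤∣p∣+∣q∣ (p ℚ.- q) q)
  where open +-*-Solver

∣p∣-∣q∣≤∣p-q∣ : ∀ p q → ℚ.∣ p ∣ ℚ.- ℚ.∣ q ∣ ℚ.≤ dist p q
∣p∣-∣q∣≤∣p-q∣ p q = subst (ℚ.∣ p ∣ ℚ.- ℚ.∣ q ∣ ℚ.≤_)
  (solve 2 (λ a b → (a :+ b) :- b := a) refl (dist p q) ℚ.∣ q ∣)
  (ℚ.+-monoˡ-≤ (ℚ.- ℚ.∣ q ∣) (∣p∣≤∣p-q∣+∣q∣ p q))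
  where open +-*-Solver

reverse-triangle : ∀ p q → dist ℚ.∣ p ∣ ℚ.∣ q ∣ ℚ.≤ dist p q
reverse-triangle p q with ℚ.∣p∣≡p∨∣p∣≡-p (ℚ.∣ p ∣ ℚ.- ℚ.∣ q ∣)
... | inj₁ eq = subst (ℚ._≤ dist p q) (sym eq) (∣p∣-∣q∣≤∣p-q∣ p q)
... | inj₂ eq = subst (ℚ._≤ dist p q)
  (trans (solve 2 (λ a b → b :- a := :- (a :- b)) refl ℚ.∣ p ∣ ℚ.∣ q ∣) (sym eq))
  (subst (ℚ.∣ q ∣ ℚ.- ℚ.∣ p ∣ ℚ.≤_) (∣∣-swap q p) (∣p∣-∣q∣≤∣p-q∣ q p))
  where open +-*-Solver

bounded : ∀ {x} → Cauchy x →
  ∃[ B ] (0ℚ ℚ.< B × ∃[ N ] (∀ n → N ℕ.≤ n → ℚ.∣ x n ∣ ℚ.≤ B))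
bounded {x} c with c 1ℚ (ℚ.positive⁻¹ 1ℚ)
... | N , h = 1ℚ ℚ.+ ℚ.∣ x N ∣
  , ℚ.+-mono-<-≤ {0ℚ} {1ℚ} {0ℚ} (ℚ.positive⁻¹ 1ℚ) (ℚ.0≤∣p∣ (x N))
  , N , λ n N≤n → ℚ.≤-trans (∣p∣≤∣p-q∣+∣q∣ (x n) (x N))
      (ℚ.+-monoˡ-≤ ℚ.∣ x N ∣ (ℚ.<⇒≤ (h n N N≤n ℕ.≤-refl)))

shrink : ∀ B ε → 0ℚ ℚ.< B → 0ℚ ℚ.< ε →
  Σ[ δ ∈ ℚ ] (0ℚ ℚ.< δ × B ℚ.* δ ≡ ½ ℚ.* ε)
shrink B ε 0<B 0<ε = δ , 0<δ , B*δ
  where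
  instance
    B-pos : ℚ.Positive B
    B-pos = ℚ.positive 0<B
    B-nz : ℚ.NonZero B
    B-nz = ℚ.pos⇒nonZero B
  δ = ℚ.1/ B ℚ.* (½ ℚ.* ε)
  B*δ : B ℚ.* δ ≡ ½ ℚ.* ε
  B*δ = trans (sym (ℚ.*-assoc B (ℚ.1/ B) (½ ℚ.* ε)))
    (trans (cong (ℚ._* (½ ℚ.* ε)) (ℚ.*-inverseʳ B)) (ℚ.*-identityˡ (½ ℚ.* ε)))
  0<δ : 0ℚ ℚ.< δ
  0<δ = ℚ.*-cancelˡ-<-nonNeg B {{ℚ.pos⇒nonNeg B}} {0ℚ} {δ}
    (subst (ℚ._< B ℚ.* δ) (sym (ℚ.*-zeroʳ B))
      (subst (0ℚ ℚ.<_) (sym B*δ) (half-pos 0<ε)))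

*-bound : ∀ {B δ p d} → 0ℚ ℚ.< B → ℚ.∣ p ∣ ℚ.≤ B → ℚ.∣ d ∣ ℚ.< δ →
  ℚ.∣ p ℚ.* d ∣ ℚ.< B ℚ.* δ
*-bound {B} {δ} {p} {d} 0<B p≤B d<δ =
  subst (ℚ._< B ℚ.* δ) (sym (ℚ.∣p*q∣≡∣p∣*∣q∣ p d))
    (ℚ.≤-<-trans
      (ℚ.*-monoʳ-≤-nonNeg ℚ.∣ d ∣ {{ℚ.∣-∣-nonNeg d}} p≤B)
      (ℚ.*-monoʳ-<-pos B {{ℚ.positive 0<B}} d<δ))

+-cauchy : ∀ {x y} → Cauchy x → Cauchy y → Cauchy (λ n → x n ℚ.+ y n)
+-cauchy {x} {y} cx cy ε 0<ε
  with cx (½ ℚ.* ε) (half-pos 0<ε) | cy (½ ℚ.* ε) (half-pos 0<ε)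
... | M , f | N , g = M ℕ.⊔ N , λ m n m≥ n≥ →
  subst (ℚ._< ε)
    (cong ℚ.∣_∣ (solve 4 (λ a b c d → (a :- b) :+ (c :- d) := (a :+ c) :- (b :+ d))
      refl (x m) (x n) (y m) (y n)))
    (ℚ.≤-<-trans (ℚ.∣p+q∣≤∣p∣+∣q∣ (x m ℚ.- x n) (y m ℚ.- y n))
      (subst (dist (x m) (x n) ℚ.+ dist (y m) (y n) ℚ.<_) (half+half ε)
        (ℚ.+-mono-<
          (f m n (ℕ.m⊔n≤o⇒m≤o M N m≥) (ℕ.m⊔n≤o⇒m≤o M N n≥))
          (g m n (ℕ.m⊔n≤o⇒n≤o M N m≥) (ℕ.m⊔n≤o⇒n≤o M N n≥)))))
  where open +-*-Solver

neg-cauchy : ∀ {x} → Cauchy x → Cauchy (λ n → ℚ.- x n)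
neg-cauchy {x} cx ε 0<ε with cx ε 0<ε
... | N , f = N , λ m n m≥ n≥ →
  subst (ℚ._< ε)
    (cong ℚ.∣_∣ (solve 2 (λ a b → b :- a := :- a :- (:- b)) refl (x m) (x n)))
    (f n m n≥ m≥)
  where open +-*-Solver

*-difference : ∀ a b c d →
  a ℚ.* (c ℚ.- d) ℚ.+ d ℚ.* (a ℚ.- b) ≡ a ℚ.* c ℚ.- b ℚ.* d
*-difference =
  solve 4 (λ a b c d → a :* (c :- d) :+ d :* (a :- b) := a :* c :- b :* d) refl
  where open +-*-Solver

*-cauchy : ∀ {x y} → Cauchy x → Cauchy y → Cauchy (λ n → x n ℚ.* y n)
*-cauchy {x} {y} cx cy ε 0<ε = from-bounds (bounded {x} cx) (bounded {y} cy)
  where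
  Bound : (ℕ → ℚ) → Set
  Bound z = ∃[ B ] (0ℚ ℚ.< B × ∃[ N ] (∀ n → N ℕ.≤ n → ℚ.∣ z n ∣ ℚ.≤ B))

  Shrink : ℚ → Set
  Shrink B = Σ[ δ ∈ ℚ ] (0ℚ ℚ.< δ × B ℚ.* δ ≡ ½ ℚ.* ε)

  Close : Set
  Close = ∃[ N ] (∀ m n → N ℕ.≤ m → N ℕ.≤ n → dist (x m ℚ.* y m) (x n ℚ.* y n) ℚ.< ε)

  from-tails : (bx : Bound x) (by : Bound y) → Shrink (proj₁ bx) → Shrink (proj₁ by) → Close
  from-tails (B , 0<B , M , bx) (C , 0<C , N , by) (δ , 0<δ , Bδ) (η , 0<η , Cη)
    with cy δ 0<δ | cx η 0<η
  ... | K , f | L , g = (M ℕ.⊔ N) ℕ.⊔ (K ℕ.⊔ L) , close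
    where
    close : ∀ m n → (M ℕ.⊔ N) ℕ.⊔ (K ℕ.⊔ L) ℕ.≤ m → (M ℕ.⊔ N) ℕ.⊔ (K ℕ.⊔ L) ℕ.≤ n →
      dist (x m ℚ.* y m) (x n ℚ.* y n) ℚ.< ε
    close m n m≥ n≥ = subst (ℚ._< ε)
      (cong ℚ.∣_∣ (*-difference (x m) (x n) (y m) (y n)))
      (ℚ.≤-<-trans
        (ℚ.∣p+q∣≤∣p∣+∣q∣ (x m ℚ.* (y m ℚ.- y n)) (y n ℚ.* (x m ℚ.- x n)))
        (subst (ℚ.∣ x m ℚ.* (y m ℚ.- y n) ∣ ℚ.+ ℚ.∣ y n ℚ.* (x m ℚ.- x n) ∣ ℚ.<_)
          (half+half ε) (ℚ.+-mono-< first second)))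
      where
      M⊔N≤ : ∀ {k} → (M ℕ.⊔ N) ℕ.⊔ (K ℕ.⊔ L) ℕ.≤ k → M ℕ.⊔ N ℕ.≤ k
      M⊔N≤ = ℕ.m⊔n≤o⇒m≤o (M ℕ.⊔ N) (K ℕ.⊔ L)
      K⊔L≤ : ∀ {k} → (M ℕ.⊔ N) ℕ.⊔ (K ℕ.⊔ L) ℕ.≤ k → K ℕ.⊔ L ℕ.≤ k
      K⊔L≤ = ℕ.m⊔n≤o⇒n≤o (M ℕ.⊔ N) (K ℕ.⊔ L)
      first : ℚ.∣ x m ℚ.* (y m ℚ.- y n) ∣ ℚ.< ½ ℚ.* ε
      first = subst (ℚ.∣ x m ℚ.* (y m ℚ.- y n) ∣ ℚ.<_) Bδ
        (*-bound {B} {δ} {x m} {y m ℚ.- y n} 0<B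
          (bx m (ℕ.m⊔n≤o⇒m≤o M N (M⊔N≤ m≥)))
          (f m n (ℕ.m⊔n≤o⇒m≤o K L (K⊔L≤ m≥)) (ℕ.m⊔n≤o⇒m≤o K L (K⊔L≤ n≥))))
      second : ℚ.∣ y n ℚ.* (x m ℚ.- x n) ∣ ℚ.< ½ ℚ.* ε
      second = subst (ℚ.∣ y n ℚ.* (x m ℚ.- x n) ∣ ℚ.<_) Cη
        (*-bound {C} {η} {y n} {x m ℚ.- x n} 0<C
          (by n (ℕ.m⊔n≤o⇒n≤o M N (M⊔N≤ n≥)))
          (g m n (ℕ.m⊔n≤o⇒n≤o K L (K⊔L≤ m≥)) (ℕ.m⊔n≤o⇒n≤o K L (K⊔L≤ n≥))))

  from-bounds : Bound x → Bound y → Close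
  from-bounds bx@(B , 0<B , _) by@(C , 0<C , _) =
    from-tails bx by (shrink B ε 0<B 0<ε) (shrink C ε 0<C 0<ε)

abs-cauchy : ∀ {x} → Cauchy x → Cauchy (λ n → ℚ.∣ x n ∣)
abs-cauchy {x} cx ε 0<ε with cx ε 0<ε
... | N , f = N , λ m n m≥ n≥ →
  ℚ.≤-<-trans (reverse-triangle (x m) (x n)) (f m n m≥ n≥)

fromℚ : ℚ → ℝ
fromℚ q = mkℝ (λ _ → q)
  (λ ε 0<ε → 0 , λ _ _ _ _ → subst (ℚ._< ε) (sym (∣p-p∣≡0 q)) 0<ε)

0ℝ : ℝ
0ℝ = fromℚ 0ℚ

infixl 6 _+_ _-_
infixl 7 _*_
infix  8 -_

_+_ : ℝ → ℝ → ℝ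
x + y = mkℝ (λ n → seq x n ℚ.+ seq y n) (+-cauchy {seq x} {seq y} (cauchy x) (cauchy y))

-_ : ℝ → ℝ
- x = mkℝ (λ n → ℚ.- seq x n) (neg-cauchy {seq x} (cauchy x))

_-_ : ℝ → ℝ → ℝ
x - y = x + (- y)

_*_ : ℝ → ℝ → ℝ
x * y = mkℝ (λ n → seq x n ℚ.* seq y n) (*-cauchy {seq x} {seq y} (cauchy x) (cauchy y))

∣_∣ : ℝ → ℝ
∣ x ∣ = mkℝ (λ n → ℚ.∣ seq x n ∣) (abs-cauchy {seq x} (cauchy x))

∑[k<_]_ : ℕ → (ℕ → ℝ) → ℝ
∑[k< zero ] f = 0ℝ
∑[k< suc n ] f = (∑[k< n ] f) + f n

_⟶_ : (ℕ → ℝ) → ℝ → Set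
f ⟶ ℓ = ∀ ε → 0ℝ < ε → ∃[ N ] (∀ n → N ℕ.≤ n → ∣ f n - ℓ ∣ < ε)

average : (N : ℕ) .{{_ : ℕ.NonZero N}} → (ℕ → ℝ) → ℝ
average N f = fromℚ (+ 1 ℚ./ N) * (∑[k< N ] f)

-- lim_{N → ∞} N⁻¹ ∑_{k ≤ N-1} f k = ℓ, with N running over 1, 2, 3, …
_⟶ᴬ_ : (ℕ → ℝ) → ℝ → Set
f ⟶ᴬ ℓ = (λ M → average (suc M) f) ⟶ ℓ

infix 4 _⟶_ _⟶ᴬ_

_^∞ : Set → Set
A ^∞ = ℕ → A

T : ∀ {A} → A ^∞ → A ^∞
T ω n = ω (suc n)

[_] : ∀ {A} → List A → Pred (A ^∞) 0ℓ
[ y ] ω = ∀ i → ω (toℕ i) ≡ lookup y i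

⋃ : ∀ {A} → (ℕ → Pred (A ^∞) 0ℓ) → Pred (A ^∞) 0ℓ
⋃ X ω = ∃[ i ] X i ω

-- The least σ-algebra containing the cylinders.  Subsets are predicates, and
-- two predicates are the same subset when they are related by _≐_; `respects`
-- closes the family under this identification.
data Borel {A : Set} : Pred (A ^∞) 0ℓ → Set₁ where
  cylinder   : ∀ y → Borel [ y ]
  complement : ∀ {X} → Borel X → Borel (∁ X)
  union      : ∀ {X : ℕ → Pred (A ^∞) 0ℓ} → (∀ i → Borel (X i)) → Borel (⋃ X)
  respects   : ∀ {X Y} → X ≐ Y → Borel X → Borel Y

record 𝓑 (A : Set) : Set₁ where
  constructor _,ᴮ_
  field
    set   : Pred (A ^∞) 0ℓ
    borel : Borel set

open 𝓑 public

∅-borel : ∀ {A} → Borel {A} ∅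
∅-borel = respects ((λ ω∉ → ω∉ (λ ())) , λ ()) (complement (cylinder []))

∅ᴮ : ∀ {A} → 𝓑 A
∅ᴮ = _ ,ᴮ ∅-borel

[_]ᴮ : ∀ {A} → List A → 𝓑 A
[ y ]ᴮ = [ y ] ,ᴮ cylinder y

⋃ᴮ : ∀ {A} → (ℕ → 𝓑 A) → 𝓑 A
⋃ᴮ X = ⋃ (set ∘ X) ,ᴮ union (borel ∘ X)

-- Values are real, so the total mass is finite; it is not assumed to be 1, so
-- probability measures are a special case.  An element of 𝓑 carries a proof of
-- measurability and an intensional predicate; μ-cong makes μ depend only on
-- the subset.
record FiniteMeasure (A : Set) : Set₁ where
  field
    μ          : 𝓑 A → ℝ
    μ-cong     : ∀ {X Y} → set X ≐ set Y → μ X ≈ μ Y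
    μ-nonneg   : ∀ X → 0ℝ ≤ μ X
    μ-∅        : μ ∅ᴮ ≈ 0ℝ
    μ-additive : ∀ (X : ℕ → 𝓑 A) → (∀ i j → i ≢ j → set (X i) ⊥ set (X j)) →
                 (λ n → ∑[k< n ] (λ i → μ (X i))) ⟶ μ (⋃ᴮ X)

∪-borel : ∀ {A} {X Y : Pred (A ^∞) 0ℓ} → Borel X → Borel Y →
  Borel (λ ω → X ω ⊎ Y ω)
∪-borel {A} {X} {Y} bX bY = respects {X = ⋃ Z} (to , from) (union {X = Z} bZ)
  where
  Z : ℕ → Pred (A ^∞) 0ℓ
  Z zero    = X
  Z (suc _) = Y
  bZ : ∀ i → Borel (Z i)
  bZ zero    = bX
  bZ (suc _) = bY
  to : ∀ {ω} → ⋃ Z ω → X ω ⊎ Y ω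
  to (zero  , x) = inj₁ x
  to (suc _ , y) = inj₂ y
  from : ∀ {ω} → X ω ⊎ Y ω → ⋃ Z ω
  from (inj₁ x) = 0 , x
  from (inj₂ y) = 1 , y

finite-∪-borel : ∀ {A} n {X : Fin n → Pred (A ^∞) 0ℓ} → (∀ j → Borel (X j)) →
  Borel (λ ω → ∃[ j ] X j ω)
finite-∪-borel zero    _ = respects ((λ ()) , λ ()) ∅-borel
finite-∪-borel {A} (suc n) {X} b =
  respects (to , from) (∪-borel (b zero) (finite-∪-borel n (b ∘ suc)))
  where
  to : ∀ {ω} → X zero ω ⊎ (∃[ j ] X (suc j) ω) → ∃[ j ] X j ω
  to (inj₁ x)       = zero , x
  to (inj₂ (j , x)) = suc j , x
  from : ∀ {ω} → ∃[ j ] X j ω → X zero ω ⊎ (∃[ j ] X (suc j) ω)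
  from (zero  , x) = inj₁ x
  from (suc j , x) = inj₂ (j , x)

-- Excluded middle is used for De Morgan duality.
∩-borel : ExcludedMiddle 0ℓ → ∀ {A} {X Y : Pred (A ^∞) 0ℓ} →
  Borel X → Borel Y → Borel (X ∩ Y)
∩-borel lem {A} {X} {Y} bX bY =
  respects (to , λ { (x , y) (inj₁ x∉) → x∉ x ; (x , y) (inj₂ y∉) → y∉ y })
    (complement (∪-borel (complement bX) (complement bY)))
  where
  to : ∀ {ω} → ∁ (λ ω → ∁ X ω ⊎ ∁ Y ω) ω → (X ∩ Y) ω
  to {ω} h with lem {X ω} | lem {Y ω}
  ... | yes x | yes y = x , y
  ... | no ¬x | _     = ⊥-elim (h (inj₁ ¬x))
  ... | _     | no ¬y = ⊥-elim (h (inj₂ ¬y))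

-- Finiteness of A is used to write T⁻¹[y] as the finite union of the cylinders
-- [a ∷ y].
T⁻¹-borel : ∀ {A n} → A ↔ Fin n → ∀ {X : Pred (A ^∞) 0ℓ} → Borel X → Borel (T ⊢ X)
T⁻¹-borel {A} {n} fin (cylinder y) =
  respects ((λ {ω} → to {ω}) , λ {ω} → from {ω})
    (finite-∪-borel n (λ j → cylinder (letter j ∷ y)))
  where
  letter : Fin n → A
  letter = Inverse.from fin
  to : ∀ {ω} → ∃[ j ] [ letter j ∷ y ] ω → [ y ] (T ω)
  to (_ , h) i = h (suc i)
  from : ∀ {ω} → [ y ] (T ω) → ∃[ j ] [ letter j ∷ y ] ω
  from {ω} h = Inverse.to fin (ω 0) ,
    λ { zero → sym (Inverse.strictlyInverseʳ fin (ω 0)) ; (suc i) → h i }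
T⁻¹-borel fin (complement b)        = complement (T⁻¹-borel fin b)
T⁻¹-borel fin (union b)             = union (λ i → T⁻¹-borel fin (b i))
T⁻¹-borel fin (respects (f , g) b)  = respects (f , g) (T⁻¹-borel fin b)

T⁻ᵏ-borel : ∀ {A n} → A ↔ Fin n → ∀ k {X : Pred (A ^∞) 0ℓ} → Borel X →
  Borel ((λ ω → iterate T ω k) ⊢ X)
T⁻ᵏ-borel fin zero    b = b
T⁻ᵏ-borel fin (suc k) b = T⁻¹-borel fin (T⁻ᵏ-borel fin k b)

module _ (lem : ExcludedMiddle 0ℓ) {A : Set} {n : ℕ} (fin : A ↔ Fin n) where

  _∩T⁻[_]_ : 𝓑 A → ℕ → 𝓑 A → 𝓑 A
  X ∩T⁻[ k ] Y = (set X ∩ ((λ ω → iterate T ω k) ⊢ set Y))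
    ,ᴮ ∩-borel lem (borel X) (T⁻ᵏ-borel fin k (borel Y))

  -- lim_{N → ∞} N⁻¹ ∑_{k ≤ N-1} μ(X ∩ T⁻ᵏ(Y)) = μ(X) μ(Y)
  MeanMixing : FiniteMeasure A → 𝓑 A → 𝓑 A → Set
  MeanMixing m X Y = (λ k → μ (X ∩T⁻[ k ] Y)) ⟶ᴬ (μ X * μ Y)
    where open FiniteMeasure m

{-# OPTIONS --safe #-}

-- Taking x empty, cylinder mixing says that the averages of μ(T⁻ᵏ[y]) converge
-- to c μ[y], where c is the total mass.  By finite additivity the same holds
-- for every set C that depends on finitely many coordinates; comparing C with
-- T⁻¹C, whose averages have the same limit, gives c μ(T⁻¹C) = c μ(C) and hence
-- μ(T⁻¹C) = μ(C), as both are at most c.  Every Borel set is approximated in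
-- measure by sets depending on finitely many coordinates, so μ is T-invariant.
-- Therefore replacing X and Y by such approximations changes each term
-- μ(X ∩ T⁻ᵏY) by a small amount, uniformly in k.
module Submission where

open import Defs
open import Axiom.ExcludedMiddle using (ExcludedMiddle)
open import Data.Empty using (⊥-elim)
open import Data.Fin.Base using (Fin; zero; suc; toℕ; fromℕ<)
open import Data.Fin.Properties using (toℕ-fromℕ<; toℕ<n; suc-injective)
open import Data.Integer.Base as ℤ using (+_; +[1+_])
import Data.Integer.Properties as ℤ
open import Data.List.Base using (List; []; _∷_; _∷ʳ_; length)
open import Data.List.Properties using (length-++)
open import Data.Nat.Base as ℕ using (ℕ; zero; suc)
open import Data.Nat.Coprimality as Coprime using (1-coprimeTo)
open import Data.Nat.GeneralisedArithmetic using (iterate)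
import Data.Nat.Properties as ℕ
open import Data.Product.Base using (Σ-syntax; ∃-syntax; _×_; _,_; proj₁; proj₂)
open import Data.Rational.Base as ℚ using (ℚ; 0ℚ; 1ℚ; ½; mkℚ)
import Data.Rational.Properties as ℚ
open import Data.Rational.Solver using (module +-*-Solver)
open import Data.Sum.Base using (inj₁; inj₂)
open import Function.Base using (id; _∘_)
open import Function.Bundles using (_↔_; _⇔_; mk⇔; Inverse)
open import Level using (0ℓ)
open import Relation.Binary.Bundles using (Preorder)
open import Relation.Binary.Definitions using (tri<; tri≈; tri>)
open import Relation.Binary.PropositionalEquality
  using (_≡_; _≢_; refl; sym; trans; cong; cong₂; subst)
import Relation.Binary.Reasoning.Preorder
open import Relation.Nullary.Decidable.Core using (yes; no)
open import Relation.Unary using (Pred; ∅; _∩_; _∪_; ∁; _≐_; _⊥_; _⊢_; _⊆_)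
open +-*-Solver using (solve; _:+_; _:-_; _:*_; :-_; _:=_; con)

-- Order and arithmetic of ℝ

-- Invariance is the obstacle, because it is not among the hypotheses. If D is close to Y, the set
-- where they differ is small, but nothing bounds a priori the measure of its preimages under T⁻ᵏ,
-- and these enter every term of the average. Nor can invariance be read off the averages for Y
-- itself, since their convergence is the goal. It has to be obtained where convergence is already
-- known and then carried over. The reals are Cauchy sequences whose order is itself defined up to
-- every rational error, so all estimates below are inequalities with a rational error, and
-- equalities are recovered by letting that error shrink.

Eventually : (ℕ → Set) → Set
Eventually P = ∃[ N ] (∀ n → N ℕ.≤ n → P n)

always : ∀ {P} → (∀ n → P n) → Eventually P
always p = 0 , λ n _ → p n

eventually-map : ∀ {P Q} → (∀ n → P n → Q n) → Eventually P → Eventually Q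
eventually-map f (N , p) = N , λ n N≤n → f n (p n N≤n)

eventually-map₂ : ∀ {P Q R} → (∀ n → P n → Q n → R n) →
  Eventually P → Eventually Q → Eventually R
eventually-map₂ f (M , p) (N , q) = M ℕ.⊔ N , λ n h →
  f n (p n (ℕ.m⊔n≤o⇒m≤o M N h)) (q n (ℕ.m⊔n≤o⇒n≤o M N h))

p<p+ε : ∀ p {ε} → 0ℚ ℚ.< ε → p ℚ.< p ℚ.+ ε
p<p+ε p {ε} 0<ε = subst (ℚ._< p ℚ.+ ε) (ℚ.+-identityʳ p) (ℚ.+-monoʳ-< p 0<ε)

p≤∣p∣ : ∀ p → p ℚ.≤ ℚ.∣ p ∣
p≤∣p∣ p with ℚ.≤-total 0ℚ p
... | inj₁ 0≤p = ℚ.≤-reflexive (sym (ℚ.0≤p⇒∣p∣≡p 0≤p))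
... | inj₂ p≤0 = ℚ.≤-trans p≤0 (ℚ.0≤∣p∣ p)

-p≤∣p∣ : ∀ p → ℚ.- p ℚ.≤ ℚ.∣ p ∣
-p≤∣p∣ p = subst (ℚ.- p ℚ.≤_) (ℚ.∣-p∣≡∣p∣ p) (p≤∣p∣ (ℚ.- p))

p-q<r⇒p<q+r : ∀ p q {r} → p ℚ.- q ℚ.< r → p ℚ.< q ℚ.+ r
p-q<r⇒p<q+r p q {r} h = subst (ℚ._< q ℚ.+ r)
  (solve 2 (λ p q → q :+ (p :- q) := p) refl p q) (ℚ.+-monoʳ-< q h)

p<q+r⇒p-q<r : ∀ p q {r} → p ℚ.< q ℚ.+ r → p ℚ.- q ℚ.< r
p<q+r⇒p-q<r p q {r} h = subst (p ℚ.- q ℚ.<_)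
  (solve 2 (λ q r → (q :+ r) :- q := r) refl q r) (ℚ.+-monoˡ-< (ℚ.- q) h)

dist<⇒< : ∀ p q {r} → dist p q ℚ.< r → p ℚ.< q ℚ.+ r
dist<⇒< p q h = p-q<r⇒p<q+r p q (ℚ.≤-<-trans (p≤∣p∣ (p ℚ.- q)) h)

<⇒dist< : ∀ p q {r} → p ℚ.< q ℚ.+ r → q ℚ.< p ℚ.+ r → dist p q ℚ.< r
<⇒dist< p q {r} h k with ℚ.∣p∣≡p∨∣p∣≡-p (p ℚ.- q)
... | inj₁ eq = subst (ℚ._< r) (sym eq) (p<q+r⇒p-q<r p q h)
... | inj₂ eq = subst (ℚ._< r)
  (trans (solve 2 (λ p q → q :- p := :- (p :- q)) refl p q) (sym eq))
  (p<q+r⇒p-q<r q p k)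

-- The condition `0ℝ ≤ x` read on a representative: its terms may be negative, but eventually only
-- by arbitrarily little.
NearlyNonneg : (ℕ → ℚ) → Set
NearlyNonneg x = ∀ ε → 0ℚ ℚ.< ε → Eventually (λ n → 0ℚ ℚ.< x n ℚ.+ ε)

Bounded : (ℕ → ℚ) → Set
Bounded x = ∃[ B ] (0ℚ ℚ.< B × Eventually (λ n → ℚ.∣ x n ∣ ℚ.≤ B))

-- If the factors have opposite signs, the negative one is close to 0 and the
-- other is bounded.
product-nearly-nonneg : ∀ {x y} → Bounded x → Bounded y →
  NearlyNonneg x → NearlyNonneg y → NearlyNonneg (λ n → x n ℚ.* y n)
product-nearly-nonneg {x} {y} (B , 0<B , bx) (C , 0<C , by) f g = estimate
  where
  small-negative : ∀ {p δ} → 0ℚ ℚ.< p ℚ.+ δ → p ℚ.≤ 0ℚ → ℚ.∣ p ∣ ℚ.< δ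
  small-negative {p} {δ} 0<p+δ p≤0 =
    subst (ℚ._< δ) (trans (sym (ℚ.0≤p⇒∣p∣≡p (ℚ.neg-antimono-≤ p≤0))) (ℚ.∣-p∣≡∣p∣ p))
      (subst (ℚ.- p ℚ.<_) (solve 2 (λ p d → :- p :+ (p :+ d) := d) refl p δ)
        (subst (ℚ._< ℚ.- p ℚ.+ (p ℚ.+ δ)) (ℚ.+-identityʳ (ℚ.- p))
          (ℚ.+-monoʳ-< (ℚ.- p) 0<p+δ)))
  nearly-nonneg : ∀ {p ε} → ℚ.∣ p ∣ ℚ.< ε → 0ℚ ℚ.< p ℚ.+ ε
  nearly-nonneg {p} {ε} h = subst (ℚ._< p ℚ.+ ε) (ℚ.+-inverseʳ p)
    (ℚ.+-monoʳ-< p (ℚ.≤-<-trans (-p≤∣p∣ p) h))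
  estimate : ∀ ε → 0ℚ ℚ.< ε →
    Eventually (λ n → 0ℚ ℚ.< x n ℚ.* y n ℚ.+ ε)
  -- The tolerances are crossed: δ belongs to the bound B of x and limits a negative y, while η
  -- belongs to the bound C of y and limits a negative x.
  estimate ε 0<ε with shrink B ε 0<B 0<ε | shrink C ε 0<C 0<ε
  ... | δ , 0<δ , Bδ | η , 0<η , Cη = eventually-map₂ step
    (eventually-map₂ (λ _ → _,_) bx by)
    (eventually-map₂ (λ _ → _,_) (f η 0<η) (g δ 0<δ))
    where
    half<ε : ½ ℚ.* ε ℚ.< ε
    half<ε = subst (½ ℚ.* ε ℚ.<_) (half+half ε) (p<p+ε (½ ℚ.* ε) (half-pos 0<ε))
    step : ∀ n → ℚ.∣ x n ∣ ℚ.≤ B × ℚ.∣ y n ∣ ℚ.≤ C →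
      0ℚ ℚ.< x n ℚ.+ η × 0ℚ ℚ.< y n ℚ.+ δ → 0ℚ ℚ.< x n ℚ.* y n ℚ.+ ε
    step n (x≤B , y≤C) (x> , y>) with ℚ.≤-total 0ℚ (x n) | ℚ.≤-total 0ℚ (y n)
    ... | inj₁ 0≤x | inj₁ 0≤y = ℚ.≤-<-trans
      (subst (ℚ._≤ x n ℚ.* y n) (ℚ.*-zeroʳ (x n))
        (ℚ.*-monoˡ-≤-nonNeg (x n) {{ℚ.nonNegative 0≤x}} 0≤y))
      (p<p+ε (x n ℚ.* y n) 0<ε)
    ... | inj₂ x≤0 | _ = nearly-nonneg {x n ℚ.* y n}
      (subst (λ p → ℚ.∣ p ∣ ℚ.< ε) (ℚ.*-comm (y n) (x n))
        (ℚ.<-trans (subst (ℚ.∣ y n ℚ.* x n ∣ ℚ.<_) Cη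
          (*-bound {C} {η} {y n} {x n} 0<C y≤C (small-negative {x n} x> x≤0)))
          half<ε))
    ... | _ | inj₂ y≤0 = nearly-nonneg {x n ℚ.* y n}
      (ℚ.<-trans (subst (ℚ.∣ x n ℚ.* y n ∣ ℚ.<_) Bδ
        (*-bound {B} {δ} {x n} {y n} 0<B x≤B (small-negative {y n} y> y≤0)))
        half<ε)

half-square-pos : ∀ {ε} → 0ℚ ℚ.< ε → 0ℚ ℚ.< ½ ℚ.* ε ℚ.* ε
half-square-pos {ε} 0<ε = subst (ℚ._< ½ ℚ.* ε ℚ.* ε) (ℚ.*-zeroˡ ε)
  (ℚ.*-monoˡ-<-pos ε {{ℚ.positive 0<ε}} (half-pos 0<ε))

-- Add the three hypotheses and cancel a + b + 2η. With η = ε / 4 the gap is ε and the conclusion is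
-- ε / 2 < c.
gap⇒large : ∀ {a b c} η → 0ℚ ℚ.< b ℚ.+ η → a ℚ.< c ℚ.+ η →
  b ℚ.+ (η ℚ.+ η ℚ.+ (η ℚ.+ η)) ℚ.≤ a → η ℚ.+ η ℚ.< c
gap⇒large {a} {b} {c} η 0<b a<c gap = subst (ℚ._< c)
  (solve 3 (λ a b h → con 0ℚ :+ a :+ (b :+ (h :+ h :+ (h :+ h))) :- (a :+ b :+ (h :+ h)) := h :+ h)
    refl a b η)
  (subst (0ℚ ℚ.+ a ℚ.+ (b ℚ.+ (η ℚ.+ η ℚ.+ (η ℚ.+ η))) ℚ.- (a ℚ.+ b ℚ.+ (η ℚ.+ η)) ℚ.<_)
    (solve 4 (λ a b c h → b :+ h :+ (c :+ h) :+ a :- (a :+ b :+ (h :+ h)) := c) refl a b c η)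
    (ℚ.+-monoˡ-< (ℚ.- (a ℚ.+ b ℚ.+ (η ℚ.+ η)))
      (ℚ.+-mono-<-≤ (ℚ.+-mono-< 0<b a<c) gap)))

-- c may vanish, but then so do a and b; if a ≥ b + ε then c ≥ ε / 2, whence
-- c a - c b ≥ ε² / 2.
cancel-estimate : ∀ {a b c ε} → 0ℚ ℚ.< ε →
  0ℚ ℚ.< b ℚ.+ ½ ℚ.* (½ ℚ.* ε) → a ℚ.< c ℚ.+ ½ ℚ.* (½ ℚ.* ε) →
  c ℚ.* a ℚ.< c ℚ.* b ℚ.+ ½ ℚ.* ε ℚ.* ε → a ℚ.< b ℚ.+ ε
cancel-estimate {a} {b} {c} {ε} 0<ε 0<b a<c ca<cb with a ℚ.<? b ℚ.+ ε
... | yes a<b+ε = a<b+ε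
... | no  a≮b+ε = ⊥-elim (ℚ.<-irrefl refl (ℚ.<-≤-trans ca<cb (ℚ.≤-trans
    (ℚ.+-monoʳ-≤ (c ℚ.* b) (ℚ.*-monoʳ-≤-nonNeg ε {{ℚ.nonNegative (ℚ.<⇒≤ 0<ε)}} (ℚ.<⇒≤ ½ε<c)))
    (subst (ℚ._≤ c ℚ.* a) (ℚ.*-distribˡ-+ c b ε)
      (ℚ.*-monoˡ-≤-nonNeg c {{ℚ.nonNegative (ℚ.<⇒≤ (ℚ.<-trans (half-pos 0<ε) ½ε<c))}}
        (ℚ.≮⇒≥ a≮b+ε))))))
  where
  quarters : ½ ℚ.* (½ ℚ.* ε) ℚ.+ ½ ℚ.* (½ ℚ.* ε) ≡ ½ ℚ.* ε
  quarters = half+half (½ ℚ.* ε)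
  ½ε<c : ½ ℚ.* ε ℚ.< c
  ½ε<c = subst (ℚ._< c) quarters (gap⇒large {a} {b} {c} (½ ℚ.* (½ ℚ.* ε)) 0<b a<c
    (subst (λ e → b ℚ.+ e ℚ.≤ a)
      (sym (trans (cong₂ ℚ._+_ quarters quarters) (half+half ε))) (ℚ.≮⇒≥ a≮b+ε)))

infix  4 _⊑_ _≃_
infixl 6 _⊕_
infixl 7 _⊛_

-- Opaque copies of Defs' operations: unification would otherwise unfold sums
-- and products down to their Cauchy moduli.
opaque

  _⊕_ : ℝ → ℝ → ℝ
  x ⊕ y = x + y

  _⊛_ : ℝ → ℝ → ℝ
  x ⊛ y = x * y

-- Records, so that the two reals can be recovered from a proof by unification;
-- Defs' _≤_ and _≈_ unfold to statements about the sequences.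
record _⊑_ (x y : ℝ) : Set where
  constructor ⊑-intro
  field ⊑-elim : x ≤ y

open _⊑_

record _≃_ (x y : ℝ) : Set where
  constructor _&_
  field
    ≃⇒⊑ : x ⊑ y
    ≃⇒⊒ : y ⊑ x

open _≃_ public

⊑-eventually : ∀ {x y} → Eventually (λ n → seq x n ℚ.≤ seq y n) → x ⊑ y
⊑-eventually {x} {y} h = ⊑-intro λ ε 0<ε →
  eventually-map (λ n x≤y → ℚ.≤-<-trans x≤y (p<p+ε (seq y n) 0<ε)) h

⊑-pointwise : ∀ {x y} → (∀ n → seq x n ℚ.≤ seq y n) → x ⊑ y
⊑-pointwise {x} {y} h = ⊑-eventually {x} {y} (always h)

≃-pointwise : ∀ {x y} → (∀ n → seq x n ≡ seq y n) → x ≃ y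
≃-pointwise {x} {y} h = ⊑-pointwise {x} {y} (λ n → ℚ.≤-reflexive (h n))
  & ⊑-pointwise {y} {x} (λ n → ℚ.≤-reflexive (sym (h n)))

⊑-refl : ∀ {x} → x ⊑ x
⊑-refl {x} = ⊑-pointwise {x} {x} (λ _ → ℚ.≤-refl)

⊑-trans : ∀ {x y z} → x ⊑ y → y ⊑ z → x ⊑ z
⊑-trans {x} {y} {z} (⊑-intro f) (⊑-intro g) = ⊑-intro λ ε 0<ε →
  eventually-map₂
    (λ n h k → ℚ.<-trans h (subst (seq y n ℚ.+ ½ ℚ.* ε ℚ.<_)
      (trans (ℚ.+-assoc (seq z n) (½ ℚ.* ε) (½ ℚ.* ε)) (cong (seq z n ℚ.+_) (half+half ε)))
      (ℚ.+-monoˡ-< (½ ℚ.* ε) k)))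
    (f (½ ℚ.* ε) (half-pos 0<ε)) (g (½ ℚ.* ε) (half-pos 0<ε))

≃-refl : ∀ {x} → x ≃ x
≃-refl = ⊑-refl & ⊑-refl

≃-sym : ∀ {x y} → x ≃ y → y ≃ x
≃-sym (p & q) = q & p

≃-trans : ∀ {x y z} → x ≃ y → y ≃ z → x ≃ z
≃-trans (p & q) (p′ & q′) = ⊑-trans p p′ & ⊑-trans q′ q

≈⇒≃ : ∀ {x y} → x ≈ y → x ≃ y
≈⇒≃ {x} {y} h =
  ⊑-intro (λ ε 0<ε → eventually-map (λ n → dist<⇒< (seq x n) (seq y n)) (h ε 0<ε))
  & ⊑-intro (λ ε 0<ε → eventually-map
      (λ n d → dist<⇒< (seq y n) (seq x n) (subst (ℚ._< ε) (∣∣-swap (seq x n) (seq y n)) d))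
      (h ε 0<ε))

opaque
  unfolding _⊕_ _⊛_

  +-mono-⊑ : ∀ {x y z w} → x ⊑ y → z ⊑ w → x ⊕ z ⊑ y ⊕ w
  +-mono-⊑ {x} {y} {z} {w} (⊑-intro f) (⊑-intro g) = ⊑-intro λ ε 0<ε →
    eventually-map₂
      (λ n h k → subst (seq x n ℚ.+ seq z n ℚ.<_)
        (trans (solve 3 (λ a b e → (a :+ e) :+ (b :+ e) := (a :+ b) :+ (e :+ e)) refl
                 (seq y n) (seq w n) (½ ℚ.* ε))
          (cong (seq y n ℚ.+ seq w n ℚ.+_) (half+half ε)))
        (ℚ.+-mono-< h k))
      (f (½ ℚ.* ε) (half-pos 0<ε)) (g (½ ℚ.* ε) (half-pos 0<ε))

  +-comm-≃ : ∀ x y → x ⊕ y ≃ y ⊕ x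
  +-comm-≃ x y = ≃-pointwise λ n → ℚ.+-comm (seq x n) (seq y n)

  +-assoc-≃ : ∀ x y z → (x ⊕ y) ⊕ z ≃ x ⊕ (y ⊕ z)
  +-assoc-≃ x y z = ≃-pointwise λ n → ℚ.+-assoc (seq x n) (seq y n) (seq z n)

  +-identityʳ-≃ : ∀ x → x ⊕ 0ℝ ≃ x
  +-identityʳ-≃ x = ≃-pointwise λ n → ℚ.+-identityʳ (seq x n)

  +-interchange-≃ : ∀ a b c d → (a ⊕ b) ⊕ (c ⊕ d) ≃ (a ⊕ c) ⊕ (b ⊕ d)
  +-interchange-≃ a b c d = ≃-pointwise λ n →
    solve 4 (λ a b c d → (a :+ b) :+ (c :+ d) := (a :+ c) :+ (b :+ d)) refl
      (seq a n) (seq b n) (seq c n) (seq d n)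

  +-cancelˡ-⊑ : ∀ z {x y} → z ⊕ x ⊑ z ⊕ y → x ⊑ y
  +-cancelˡ-⊑ z {x} {y} (⊑-intro f) = ⊑-intro λ ε 0<ε → eventually-map
    (λ n h → subst (seq x n ℚ.<_)
        (solve 3 (λ z y e → :- z :+ ((z :+ y) :+ e) := y :+ e) refl (seq z n) (seq y n) ε)
      (subst (ℚ._< ℚ.- seq z n ℚ.+ (seq z n ℚ.+ seq y n ℚ.+ ε))
        (solve 2 (λ z x → :- z :+ (z :+ x) := x) refl (seq z n) (seq x n))
        (ℚ.+-monoʳ-< (ℚ.- seq z n) h)))
    (f ε 0<ε)

  fromℚ-half+half : ∀ q → fromℚ (½ ℚ.* q) ⊕ fromℚ (½ ℚ.* q) ≃ fromℚ q
  fromℚ-half+half q = ≃-pointwise λ _ → half+half q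

  -- The order already allows every rational slack, so an additional slack q only costs halving ε.
  -- This turns estimates up to every error into exact inequalities.
  ⊑-closed : ∀ {x y} → (∀ q → 0ℚ ℚ.< q → x ⊑ y ⊕ fromℚ q) → x ⊑ y
  ⊑-closed {x} {y} h = ⊑-intro λ ε 0<ε → eventually-map
    (λ n → subst (seq x n ℚ.<_)
      (trans (ℚ.+-assoc (seq y n) (½ ℚ.* ε) (½ ℚ.* ε)) (cong (seq y n ℚ.+_) (half+half ε))))
    (⊑-elim (h (½ ℚ.* ε) (half-pos 0<ε)) (½ ℚ.* ε) (half-pos 0<ε))

  *-nonneg : ∀ {x y} → 0ℝ ⊑ x → 0ℝ ⊑ y → 0ℝ ⊑ x ⊛ y
  *-nonneg {x} {y} (⊑-intro f) (⊑-intro g) = ⊑-intro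
    (product-nearly-nonneg (bounded {seq x} (cauchy x)) (bounded {seq y} (cauchy y)) f g)

  *-monoˡ-⊑ : ∀ {c x y} → 0ℝ ⊑ c → x ⊑ y → c ⊛ x ⊑ c ⊛ y
  *-monoˡ-⊑ {c} {x} {y} 0⊑c (⊑-intro x⊑y) = ⊑-intro λ ε 0<ε → eventually-map
    (λ n h → subst (ℚ._< seq c n ℚ.* seq y n ℚ.+ ε) (ℚ.+-identityʳ (seq c n ℚ.* seq x n))
      (subst (seq c n ℚ.* seq x n ℚ.+ 0ℚ ℚ.<_)
        (solve 4 (λ c x y e → c :* x :+ (c :* (y :- x) :+ e) := c :* y :+ e) refl
          (seq c n) (seq x n) (seq y n) ε)
        (ℚ.+-monoʳ-< (seq c n ℚ.* seq x n) h)))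
    (⊑-elim (*-nonneg {c} {y - x} 0⊑c 0⊑y-x) ε 0<ε)
    where
    0⊑y-x : 0ℝ ⊑ y - x
    0⊑y-x = ⊑-intro λ ε 0<ε → eventually-map
      (λ n h → subst (ℚ._< seq y n ℚ.- seq x n ℚ.+ ε) (ℚ.+-inverseʳ (seq x n))
        (subst (seq x n ℚ.- seq x n ℚ.<_)
          (solve 3 (λ x y e → (y :+ e) :- x := (y :- x) :+ e) refl (seq x n) (seq y n) ε)
          (ℚ.+-monoˡ-< (ℚ.- seq x n) h)))
      (x⊑y ε 0<ε)

  *-comm-≃ : ∀ x y → x ⊛ y ≃ y ⊛ x
  *-comm-≃ x y = ≃-pointwise λ n → ℚ.*-comm (seq x n) (seq y n)

  *-distribˡ-≃ : ∀ c x y → c ⊛ (x ⊕ y) ≃ c ⊛ x ⊕ c ⊛ y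
  *-distribˡ-≃ c x y = ≃-pointwise λ n → ℚ.*-distribˡ-+ (seq c n) (seq x n) (seq y n)

  *-distribʳ-≃ : ∀ c x y → (x ⊕ y) ⊛ c ≃ x ⊛ c ⊕ y ⊛ c
  *-distribʳ-≃ c x y = ≃-pointwise λ n → ℚ.*-distribʳ-+ (seq c n) (seq x n) (seq y n)

  *-zeroʳ-≃ : ∀ c → c ⊛ 0ℝ ≃ 0ℝ
  *-zeroʳ-≃ c = ≃-pointwise {c ⊛ 0ℝ} {0ℝ} λ n → ℚ.*-zeroʳ (seq c n)

  *-zeroˡ-≃ : ∀ c → 0ℝ ⊛ c ≃ 0ℝ
  *-zeroˡ-≃ c = ≃-pointwise {0ℝ ⊛ c} {0ℝ} λ n → ℚ.*-zeroˡ (seq c n)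

  -- Cancels the total mass c in `finitary-invariant`, where c may be 0: the bound a ⊑ c replaces
  -- positivity of c, since it makes a vanish together with c.
  *-cancel-below : ∀ {a b c} → 0ℝ ⊑ b → a ⊑ c → c ⊛ a ⊑ c ⊛ b → a ⊑ b
  *-cancel-below {a} {b} {c} (⊑-intro 0⊑b) (⊑-intro a⊑c) (⊑-intro ca⊑cb) = ⊑-intro λ ε 0<ε →
    eventually-map₂
      (λ n 0<b (a<c , ca<cb) → cancel-estimate {seq a n} {seq b n} {seq c n} 0<ε 0<b a<c ca<cb)
      (0⊑b (½ ℚ.* (½ ℚ.* ε)) (half-pos (half-pos 0<ε)))
      (eventually-map₂ (λ _ → _,_) (a⊑c (½ ℚ.* (½ ℚ.* ε)) (half-pos (half-pos 0<ε)))
        (ca⊑cb (½ ℚ.* ε ℚ.* ε) (half-square-pos 0<ε)))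

+-monoˡ-⊑ : ∀ z {x y} → x ⊑ y → x ⊕ z ⊑ y ⊕ z
+-monoˡ-⊑ z h = +-mono-⊑ h ⊑-refl

+-monoʳ-⊑ : ∀ z {x y} → x ⊑ y → z ⊕ x ⊑ z ⊕ y
+-monoʳ-⊑ z h = +-mono-⊑ (⊑-refl {z}) h

+-cong-≃ : ∀ {x y z w} → x ≃ y → z ≃ w → x ⊕ z ≃ y ⊕ w
+-cong-≃ (p & q) (p′ & q′) = +-mono-⊑ p p′ & +-mono-⊑ q q′

x⊑x+y : ∀ x {y} → 0ℝ ⊑ y → x ⊑ x ⊕ y
x⊑x+y x h = ⊑-trans (≃⇒⊒ (+-identityʳ-≃ x)) (+-monoʳ-⊑ x h)

fromℚ-mono : ∀ {p q} → p ℚ.≤ q → fromℚ p ⊑ fromℚ q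
fromℚ-mono {p} {q} h = ⊑-pointwise {fromℚ p} {fromℚ q} (λ _ → h)

rational-bound : ∀ x → Σ[ B ∈ ℚ ] (0ℚ ℚ.< B × x ⊑ fromℚ B)
rational-bound x =
  let B , 0<B , ev = bounded {seq x} (cauchy x)
  in B , 0<B , ⊑-eventually (eventually-map (λ n → ℚ.≤-trans (p≤∣p∣ (seq x n))) ev)

*-monoʳ-⊑ : ∀ {c x y} → 0ℝ ⊑ c → x ⊑ y → x ⊛ c ⊑ y ⊛ c
*-monoʳ-⊑ {c} {x} {y} 0⊑c x⊑y = ⊑-trans (≃⇒⊑ (*-comm-≃ x c))
  (⊑-trans (*-monoˡ-⊑ 0⊑c x⊑y) (≃⇒⊑ (*-comm-≃ c y)))

*-congˡ-≃ : ∀ {c x y} → 0ℝ ⊑ c → x ≃ y → c ⊛ x ≃ c ⊛ y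
*-congˡ-≃ 0⊑c (p & q) = *-monoˡ-⊑ 0⊑c p & *-monoˡ-⊑ 0⊑c q

*-congʳ-≃ : ∀ {c x y} → 0ℝ ⊑ c → x ≃ y → x ⊛ c ≃ y ⊛ c
*-congʳ-≃ 0⊑c (p & q) = *-monoʳ-⊑ 0⊑c p & *-monoʳ-⊑ 0⊑c q

-- Limits and averages

⊑-preorder : Preorder 0ℓ 0ℓ 0ℓ
⊑-preorder = record
  { Carrier    = ℝ
  ; _≈_        = _≃_
  ; _≲_        = _⊑_
  ; isPreorder = record
    { isEquivalence = record { refl = ≃-refl ; sym = ≃-sym ; trans = ≃-trans }
    ; reflexive     = ≃⇒⊑
    ; trans         = ⊑-trans
    }
  }

module ⊑-Reasoning = Relation.Binary.Reasoning.Preorder ⊑-preorder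

open ⊑-Reasoning

-- Two one-sided inequalities in place of an absolute value, so that estimates reduce to
-- monotonicity and chains of `_⊑_`.
record Near (e x y : ℝ) : Set where
  constructor near
  field
    upper : x ⊑ y ⊕ e
    lower : y ⊑ x ⊕ e

open Near

near-sym : ∀ {e x y} → Near e x y → Near e y x
near-sym (near u l) = near l u

near-weaken : ∀ {d e x y} → d ⊑ e → Near d x y → Near e x y
near-weaken {x = x} {y} d⊑e (near u l) =
  near (⊑-trans u (+-monoʳ-⊑ y d⊑e)) (⊑-trans l (+-monoʳ-⊑ x d⊑e))

≃⇒near : ∀ {e x y} → 0ℝ ⊑ e → x ≃ y → Near e x y
≃⇒near {e} {x} {y} 0⊑e (x⊑y & y⊑x) = near (⊑-trans x⊑y (x⊑x+y y 0⊑e)) (⊑-trans y⊑x (x⊑x+y x 0⊑e))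

near-cong : ∀ {e x x′ y y′} → x ≃ x′ → y ≃ y′ → Near e x y → Near e x′ y′
near-cong {e} (x⊑x′ & x′⊑x) (y⊑y′ & y′⊑y) (near u l) = near
  (⊑-trans x′⊑x (⊑-trans u (+-monoˡ-⊑ e y⊑y′)))
  (⊑-trans y′⊑y (⊑-trans l (+-monoˡ-⊑ e x⊑x′)))

⊑-near-trans : ∀ {d e x y z} → x ⊑ y ⊕ d → y ⊑ z ⊕ e → x ⊑ z ⊕ (d ⊕ e)
⊑-near-trans {d} {e} {x} {y} {z} x⊑y y⊑z = begin
  x             ≲⟨ x⊑y ⟩
  y ⊕ d         ≲⟨ +-monoˡ-⊑ d y⊑z ⟩
  z ⊕ e ⊕ d     ≈⟨ +-assoc-≃ z e d ⟩
  z ⊕ (e ⊕ d)   ≲⟨ +-monoʳ-⊑ z (≃⇒⊑ (+-comm-≃ e d)) ⟩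
  z ⊕ (d ⊕ e)   ∎

near-trans : ∀ {d e x y z} → Near d x y → Near e y z → Near (d ⊕ e) x z
near-trans {d} {e} {x} (near u l) (near u′ l′) = near (⊑-near-trans u u′)
  (⊑-trans (⊑-near-trans l′ l) (+-monoʳ-⊑ x (≃⇒⊑ (+-comm-≃ e d))))

near-half-trans : ∀ q {x y z} → Near (fromℚ (½ ℚ.* q)) x y → Near (fromℚ (½ ℚ.* q)) y z →
  Near (fromℚ q) x z
near-half-trans q h k = near-weaken (≃⇒⊑ (fromℚ-half+half q)) (near-trans h k)

near-⊕ : ∀ {d e x y z w} → Near d x y → Near e z w → Near (d ⊕ e) (x ⊕ z) (y ⊕ w)
near-⊕ {d} {e} {x} {y} {z} {w} (near u l) (near u′ l′) = near
  (⊑-trans (+-mono-⊑ u u′) (≃⇒⊑ (+-interchange-≃ y d w e)))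
  (⊑-trans (+-mono-⊑ l l′) (≃⇒⊑ (+-interchange-≃ x d z e)))

-- The factors are replaced one at a time: ab ≤ a′b + db ≤ a′b′ + a′d + db. The errors multiply a′
-- and b, which is why these two are bounded by B.
⊛-near : ∀ {B d a a′ b b′} → 0ℝ ⊑ d → 0ℝ ⊑ a′ → 0ℝ ⊑ b → a′ ⊑ B → b ⊑ B →
  a ⊑ a′ ⊕ d → b ⊑ b′ ⊕ d → a ⊛ b ⊑ a′ ⊛ b′ ⊕ (d ⊛ B ⊕ d ⊛ B)
⊛-near {B} {d} {a} {a′} {b} {b′} 0⊑d 0⊑a′ 0⊑b a′⊑B b⊑B a⊑a′ b⊑b′ = begin
  a ⊛ b                                ≲⟨ *-monoʳ-⊑ 0⊑b a⊑a′ ⟩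
  (a′ ⊕ d) ⊛ b                         ≈⟨ *-distribʳ-≃ b a′ d ⟩
  a′ ⊛ b ⊕ d ⊛ b                       ≲⟨ +-mono-⊑ (*-monoˡ-⊑ 0⊑a′ b⊑b′) (*-monoˡ-⊑ 0⊑d b⊑B) ⟩
  a′ ⊛ (b′ ⊕ d) ⊕ d ⊛ B                ≲⟨ +-monoˡ-⊑ (d ⊛ B) (≃⇒⊑ (*-distribˡ-≃ a′ b′ d)) ⟩
  a′ ⊛ b′ ⊕ a′ ⊛ d ⊕ d ⊛ B             ≲⟨ +-monoˡ-⊑ (d ⊛ B) (+-monoʳ-⊑ (a′ ⊛ b′) (≃⇒⊑ (*-comm-≃ a′ d))) ⟩
  a′ ⊛ b′ ⊕ d ⊛ a′ ⊕ d ⊛ B             ≲⟨ +-monoˡ-⊑ (d ⊛ B) (+-monoʳ-⊑ (a′ ⊛ b′) (*-monoˡ-⊑ 0⊑d a′⊑B)) ⟩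
  a′ ⊛ b′ ⊕ d ⊛ B ⊕ d ⊛ B              ≈⟨ +-assoc-≃ (a′ ⊛ b′) (d ⊛ B) (d ⊛ B) ⟩
  a′ ⊛ b′ ⊕ (d ⊛ B ⊕ d ⊛ B)            ∎

infix 4 _⇝_

-- Defs' _⟶_, with rational tolerances only.
record _⇝_ (f : ℕ → ℝ) (ℓ : ℝ) : Set where
  constructor ⇝-intro
  field eventually-near : ∀ q → 0ℚ ℚ.< q → Eventually (λ n → Near (fromℚ q) (f n) ℓ)

open _⇝_

opaque
  unfolding _⊕_

  dist<⇒near : ∀ {x y q} → ∣ x - y ∣ < fromℚ q → Near (fromℚ q) x y
  dist<⇒near {x} {y} {q} (δ , 0<δ , ev) = near
    (⊑-eventually (eventually-map (λ n h → ℚ.<⇒≤ (dist<⇒< (seq x n) (seq y n) (dist<q n h))) ev))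
    (⊑-eventually (eventually-map (λ n h → ℚ.<⇒≤ (dist<⇒< (seq y n) (seq x n)
      (subst (ℚ._< q) (∣∣-swap (seq x n) (seq y n)) (dist<q n h)))) ev))
    where
    dist<q : ∀ n → dist (seq x n) (seq y n) ℚ.+ δ ℚ.≤ q → dist (seq x n) (seq y n) ℚ.< q
    dist<q n h = ℚ.<-≤-trans (p<p+ε (dist (seq x n) (seq y n)) 0<δ) h

  -- A quarter of δ is the given error and another quarter is the slack in `_⊑_`. The distance is
  -- thus below δ / 2, and the other half of δ remains as the gap that a strict inequality of reals
  -- requires.
  near⇒dist< : ∀ {x y ε δ} → 0ℚ ℚ.< δ → Eventually (λ n → 0ℚ ℚ.+ δ ℚ.≤ seq ε n) →
    Near (fromℚ (½ ℚ.* (½ ℚ.* δ))) x y → ∣ x - y ∣ < ε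
  near⇒dist< {x} {y} {ε} {δ} 0<δ δ≤ε (near u l) = ½ ℚ.* δ , half-pos 0<δ ,
    eventually-map₂
      (λ n h (d , d′) → ℚ.≤-trans
        (ℚ.<⇒≤ (ℚ.+-monoˡ-< (½ ℚ.* δ) (<⇒dist< (seq x n) (seq y n)
          (subst (seq x n ℚ.<_) (join (seq y n)) d) (subst (seq y n ℚ.<_) (join (seq x n)) d′))))
        (subst (ℚ._≤ seq ε n) (trans (ℚ.+-identityˡ δ) (sym (half+half δ))) h))
      δ≤ε
      (eventually-map₂ (λ _ → _,_)
        (⊑-elim u (½ ℚ.* (½ ℚ.* δ)) (half-pos (half-pos 0<δ)))
        (⊑-elim l (½ ℚ.* (½ ℚ.* δ)) (half-pos (half-pos 0<δ))))
    where
    join : ∀ p → p ℚ.+ ½ ℚ.* (½ ℚ.* δ) ℚ.+ ½ ℚ.* (½ ℚ.* δ) ≡ p ℚ.+ ½ ℚ.* δ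
    join p = trans (ℚ.+-assoc p (½ ℚ.* (½ ℚ.* δ)) (½ ℚ.* (½ ℚ.* δ)))
      (cong (p ℚ.+_) (half+half (½ ℚ.* δ)))

fromℚ-pos : ∀ {q} → 0ℚ ℚ.< q → 0ℝ < fromℚ q
fromℚ-pos {q} 0<q = q , 0<q , always (λ _ → ℚ.≤-reflexive (ℚ.+-identityˡ q))

fromℚ-nonneg : ∀ {q} → 0ℚ ℚ.< q → 0ℝ ⊑ fromℚ q
fromℚ-nonneg 0<q = fromℚ-mono (ℚ.<⇒≤ 0<q)

⟶⇒⇝ : ∀ {f ℓ} → f ⟶ ℓ → f ⇝ ℓ
⟶⇒⇝ h = ⇝-intro λ q 0<q → eventually-map (λ _ → dist<⇒near) (h (fromℚ q) (fromℚ-pos 0<q))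

⇝⇒⟶ : ∀ {f ℓ} → f ⇝ ℓ → f ⟶ ℓ
⇝⇒⟶ {f} {ℓ} (⇝-intro h) ε (δ , 0<δ , δ≤ε) = eventually-map
  (λ n → near⇒dist< {f n} {ℓ} {ε} 0<δ δ≤ε)
  (h (½ ℚ.* (½ ℚ.* δ)) (half-pos (half-pos 0<δ)))

⇝-cong : ∀ {f g k ℓ} → (∀ n → f n ≃ g n) → k ≃ ℓ → f ⇝ k → g ⇝ ℓ
⇝-cong f≃g k≃ℓ (⇝-intro h) = ⇝-intro λ q 0<q →
  eventually-map (λ n → near-cong (f≃g n) k≃ℓ) (h q 0<q)

⇝-eventually-const : ∀ {f ℓ} → Eventually (λ n → f n ≃ ℓ) → f ⇝ ℓ
⇝-eventually-const ev = ⇝-intro λ q 0<q → eventually-map (λ n → ≃⇒near (fromℚ-nonneg 0<q)) ev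

⇝-⊕ : ∀ {f g k ℓ} → f ⇝ k → g ⇝ ℓ → (λ n → f n ⊕ g n) ⇝ k ⊕ ℓ
⇝-⊕ (⇝-intro h) (⇝-intro h′) = ⇝-intro λ q 0<q → eventually-map₂
  (λ n c c′ → near-weaken (≃⇒⊑ (fromℚ-half+half q)) (near-⊕ c c′))
  (h (½ ℚ.* q) (half-pos 0<q)) (h′ (½ ℚ.* q) (half-pos 0<q))

⇝-near : ∀ {f g ℓ} → (∀ q → 0ℚ ℚ.< q → Eventually (λ n → Near (fromℚ q) (g n) (f n))) →
  f ⇝ ℓ → g ⇝ ℓ
⇝-near gf (⇝-intro h) = ⇝-intro λ q 0<q → eventually-map₂
  (λ n → near-half-trans q) (gf (½ ℚ.* q) (half-pos 0<q)) (h (½ ℚ.* q) (half-pos 0<q))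

-- The three-step estimate f n ~ g n ~ k ~ ℓ. Only the middle step selects a threshold, because the
-- first holds uniformly in n; hence g and k may vary with q.
⇝-approx : ∀ {f ℓ} →
  (∀ q → 0ℚ ℚ.< q → Σ[ g ∈ (ℕ → ℝ) ] ∃[ k ]
    (g ⇝ k × (∀ n → Near (fromℚ q) (f n) (g n)) × Near (fromℚ q) k ℓ)) →
  f ⇝ ℓ
⇝-approx h = ⇝-intro λ q 0<q →
  let 0<½q = half-pos 0<q
      g , k , ⇝-intro c , fg , kℓ = h (½ ℚ.* (½ ℚ.* q)) (half-pos 0<½q)
  in eventually-map
    (λ n gk → near-half-trans q
      (near-weaken (fromℚ-mono (quarter≤half 0<½q)) (fg n)) (near-half-trans (½ ℚ.* q) gk kℓ))
    (c (½ ℚ.* (½ ℚ.* q)) (half-pos 0<½q))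
  where
  quarter≤half : ∀ {p} → 0ℚ ℚ.< p → ½ ℚ.* p ℚ.≤ p
  quarter≤half {p} 0<p = ℚ.<⇒≤ (subst (½ ℚ.* p ℚ.<_) (half+half p) (p<p+ε (½ ℚ.* p) (half-pos 0<p)))

⇝-unique-⊑ : ∀ {f k ℓ} → f ⇝ k → f ⇝ ℓ → k ⊑ ℓ
⇝-unique-⊑ (⇝-intro h) (⇝-intro h′) = ⊑-closed λ q 0<q →
  let N , c = eventually-map₂ (λ n d d′ → upper (near-half-trans q (near-sym d) d′))
                (h (½ ℚ.* q) (half-pos 0<q)) (h′ (½ ℚ.* q) (half-pos 0<q))
  in c N ℕ.≤-refl

⇝-unique : ∀ {f k ℓ} → f ⇝ k → f ⇝ ℓ → k ≃ ℓ
⇝-unique h h′ = ⇝-unique-⊑ h h′ & ⇝-unique-⊑ h′ h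

-- The sums and averages of the statement, rebuilt on the opaque operations. `mean M` averages the M
-- + 1 terms with indices 0 to M.
sum : ℕ → (ℕ → ℝ) → ℝ
sum zero    f = 0ℝ
sum (suc n) f = sum n f ⊕ f n

mean : ℕ → (ℕ → ℝ) → ℝ
mean M f = fromℚ (+ 1 ℚ./ suc M) ⊛ sum (suc M) f

opaque
  unfolding _⊕_ _⊛_

  ∑≡sum : ∀ n f → ∑[k< n ] f ≡ sum n f
  ∑≡sum zero    f = refl
  ∑≡sum (suc n) f = cong (_+ f n) (∑≡sum n f)

  average≡mean : ∀ M f → average (suc M) f ≡ mean M f
  average≡mean M f = cong (fromℚ (+ 1 ℚ./ suc M) *_)
    {∑[k< suc M ] f} {sum (suc M) f} (∑≡sum (suc M) f)

  *≡⊛ : ∀ x y → x * y ≡ x ⊛ y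
  *≡⊛ x y = refl

⟶ᴬ⇒⇝ : ∀ {f x y} → f ⟶ᴬ (x * y) → (λ M → mean M f) ⇝ x ⊛ y
⟶ᴬ⇒⇝ {f} {x} {y} h = subst ((λ M → mean M f) ⇝_) (*≡⊛ x y)
  (⇝-cong (λ M → subst (average (suc M) f ≃_) (average≡mean M f) ≃-refl) ≃-refl (⟶⇒⇝ h))

⇝⇒⟶ᴬ : ∀ {f x y} → (λ M → mean M f) ⇝ x ⊛ y → f ⟶ᴬ (x * y)
⇝⇒⟶ᴬ {f} {x} {y} h = ⇝⇒⟶ (⇝-cong
  (λ M → subst (mean M f ≃_) (sym (average≡mean M f)) ≃-refl) ≃-refl
  (subst ((λ M → mean M f) ⇝_) (sym (*≡⊛ x y)) h))

sum-mono : ∀ n {f g} → (∀ k → f k ⊑ g k) → sum n f ⊑ sum n g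
sum-mono zero    h = ⊑-refl
sum-mono (suc n) h = +-mono-⊑ (sum-mono n h) (h n)

sum-⊕ : ∀ n f g → sum n (λ k → f k ⊕ g k) ≃ sum n f ⊕ sum n g
sum-⊕ zero    f g = ≃-sym (+-identityʳ-≃ 0ℝ)
sum-⊕ (suc n) f g = ≃-trans (+-cong-≃ (sum-⊕ n f g) ≃-refl)
  (+-interchange-≃ (sum n f) (sum n g) (f n) (g n))

-- Both sides are the sum of the first n + 1 terms, with the first or the last one split off. A
-- shift therefore changes a sum by two end terms only.
sum-shift : ∀ n f → f 0 ⊕ sum n (f ∘ suc) ≃ sum n f ⊕ f n
sum-shift zero    f = +-comm-≃ (f 0) 0ℝ
sum-shift (suc n) f = ≃-trans (≃-sym (+-assoc-≃ (f 0) (sum n (f ∘ suc)) (f (suc n))))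
  (+-cong-≃ (sum-shift n f) ≃-refl)

-- Written in lowest terms, so that numerator and denominator are visible; `_/_` reaches this form
-- only after division by a gcd.
unitFraction : ℕ → ℚ
unitFraction M = mkℚ (+ 1) M (1-coprimeTo (suc M))

1/suc≡unitFraction : ∀ M → + 1 ℚ./ suc M ≡ unitFraction M
1/suc≡unitFraction M = ℚ.↥p/↧p≡p (unitFraction M)

fromℕ : ℕ → ℚ
fromℕ n = mkℚ (+ n) 0 (Coprime.sym (1-coprimeTo n))

fromℕ-suc : ∀ n → fromℕ n ℚ.+ 1ℚ ≡ fromℕ (suc n)
fromℕ-suc n = trans
  (cong (ℚ._/ 1) (trans (cong (ℤ._+ + 1) (ℤ.*-identityʳ (+ n))) (ℤ.+-comm (+ n) (+ 1))))
  (ℚ.↥p/↧p≡p (fromℕ (suc n)))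

1/suc*suc≡1 : ∀ M → (+ 1 ℚ./ suc M) ℚ.* fromℕ (suc M) ≡ 1ℚ
1/suc*suc≡1 M = trans (cong (ℚ._* fromℕ (suc M)) (1/suc≡unitFraction M))
  -- The reciprocal swaps numerator and denominator, so it is `fromℕ (suc M)` by computation.
  (ℚ.*-inverseʳ (unitFraction M))

1/suc-pos : ∀ M → 0ℚ ℚ.< + 1 ℚ./ suc M
1/suc-pos M = subst (0ℚ ℚ.<_) (sym (1/suc≡unitFraction M)) (ℚ.positive⁻¹ (unitFraction M))

-- The threshold is read off the denominator: (k + 1) / (d + 1) is at least 1 / (d + 1).
1/suc-eventually-≤ : ∀ δ → 0ℚ ℚ.< δ → Eventually (λ M → + 1 ℚ./ suc M ℚ.≤ δ)
1/suc-eventually-≤ (mkℚ (+ 0) d c) (ℚ.*<* (ℤ.+<+ ()))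
1/suc-eventually-≤ δ@(mkℚ (+[1+ k ]) d c) 0<δ = d , λ M d≤M →
  subst (ℚ._≤ δ) (sym (1/suc≡unitFraction M)) (ℚ.*≤* (ℤ.+≤+ (ℕ.≤-trans
    (ℕ.≤-reflexive (ℕ.+-identityʳ (suc d))) (ℕ.≤-trans (ℕ.s≤s d≤M) (ℕ.m≤m+n (suc M) (k ℕ.* suc M))))))
1/suc-eventually-≤ (mkℚ (ℤ.-[1+ k ]) d c) (ℚ.*<* ())

opaque
  unfolding _⊕_ _⊛_

  sum-const : ∀ n c i → seq (sum n (λ _ → c)) i ≡ fromℕ n ℚ.* seq c i
  sum-const zero    c i = sym (ℚ.*-zeroˡ (seq c i))
  sum-const (suc n) c i = trans (cong (ℚ._+ seq c i) (sum-const n c i))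
    (trans (solve 2 (λ n c → n :* c :+ c := (n :+ con 1ℚ) :* c) refl (fromℕ n) (seq c i))
      (cong (ℚ._* seq c i) (fromℕ-suc n)))

  mean-const : ∀ M c → mean M (λ _ → c) ≃ c
  mean-const M c = ≃-pointwise λ i →
    trans (cong ((+ 1 ℚ./ suc M) ℚ.*_) (sum-const (suc M) c i))
      (trans (sym (ℚ.*-assoc (+ 1 ℚ./ suc M) (fromℕ (suc M)) (seq c i)))
        (trans (cong (ℚ._* seq c i) (1/suc*suc≡1 M)) (ℚ.*-identityˡ (seq c i))))

  fromℚ-⊛ : ∀ p q → fromℚ p ⊛ fromℚ q ≃ fromℚ (p ℚ.* q)
  fromℚ-⊛ p q = ≃-pointwise λ _ → refl

mean-mono : ∀ M {f g} → (∀ k → f k ⊑ g k) → mean M f ⊑ mean M g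
mean-mono M h = *-monoˡ-⊑ (fromℚ-nonneg (1/suc-pos M)) (sum-mono (suc M) h)

mean-cong : ∀ M {f g} → (∀ k → f k ≃ g k) → mean M f ≃ mean M g
mean-cong M h = mean-mono M (λ k → ≃⇒⊑ (h k)) & mean-mono M (λ k → ≃⇒⊒ (h k))

mean-⊕ : ∀ M f g → mean M (λ k → f k ⊕ g k) ≃ mean M f ⊕ mean M g
mean-⊕ M f g = ≃-trans (*-congˡ-≃ (fromℚ-nonneg (1/suc-pos M)) (sum-⊕ (suc M) f g))
  (*-distribˡ-≃ (fromℚ (+ 1 ℚ./ suc M)) (sum (suc M) f) (sum (suc M) g))

-- The weights add up to 1, so an error uniform in k passes through the average unchanged. This is
-- why `meet-near` must give a bound independent of k.
mean-⊑ : ∀ M {f g e} → (∀ k → f k ⊑ g k ⊕ e) → mean M f ⊑ mean M g ⊕ e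
mean-⊑ M {f} {g} {e} h = begin
  mean M f                     ≲⟨ mean-mono M h ⟩
  mean M (λ k → g k ⊕ e)       ≈⟨ mean-⊕ M g (λ _ → e) ⟩
  mean M g ⊕ mean M (λ _ → e)  ≲⟨ +-monoʳ-⊑ (mean M g) (≃⇒⊑ (mean-const M e)) ⟩
  mean M g ⊕ e                 ∎

mean-near : ∀ M {f g e} → (∀ k → Near e (f k) (g k)) → Near e (mean M f) (mean M g)
mean-near M h = near (mean-⊑ M (λ k → upper (h k))) (mean-⊑ M (λ k → lower (h k)))

-- The two sums differ by one term at each end, hence by at most c, and the factor 1 / (M + 1) sends
-- this difference to 0.
⇝-mean-suc : ∀ {f c ℓ} → (∀ k → 0ℝ ⊑ f k) → (∀ k → f k ⊑ c) →
  (λ M → mean M f) ⇝ ℓ → (λ M → mean M (f ∘ suc)) ⇝ ℓ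
⇝-mean-suc {f} {c} {ℓ} 0⊑f f⊑c = ⇝-near close
  where
  sum-near : ∀ n → Near c (sum n (f ∘ suc)) (sum n f)
  sum-near n = near
    (begin
      sum n (f ∘ suc)        ≲⟨ x⊑x+y _ (0⊑f 0) ⟩
      sum n (f ∘ suc) ⊕ f 0  ≈⟨ +-comm-≃ _ (f 0) ⟩
      f 0 ⊕ sum n (f ∘ suc)  ≈⟨ sum-shift n f ⟩
      sum n f ⊕ f n          ≲⟨ +-monoʳ-⊑ (sum n f) (f⊑c n) ⟩
      sum n f ⊕ c            ∎)
    (begin
      sum n f                ≲⟨ x⊑x+y _ (0⊑f n) ⟩
      sum n f ⊕ f n          ≈⟨ sum-shift n f ⟨
      f 0 ⊕ sum n (f ∘ suc)  ≈⟨ +-comm-≃ (f 0) _ ⟩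
      sum n (f ∘ suc) ⊕ f 0  ≲⟨ +-monoʳ-⊑ (sum n (f ∘ suc)) (f⊑c 0) ⟩
      sum n (f ∘ suc) ⊕ c    ∎)
  scale : ∀ r {x y} → 0ℝ ⊑ r → Near c x y → Near (r ⊛ c) (r ⊛ x) (r ⊛ y)
  scale r {x} {y} 0⊑r (near u l) = near
    (⊑-trans (*-monoˡ-⊑ 0⊑r u) (≃⇒⊑ (*-distribˡ-≃ r y c)))
    (⊑-trans (*-monoˡ-⊑ 0⊑r l) (≃⇒⊑ (*-distribˡ-≃ r x c)))
  close : ∀ q → 0ℚ ℚ.< q → Eventually (λ M → Near (fromℚ q) (mean M (f ∘ suc)) (mean M f))
  close q 0<q =
    let B , 0<B , c⊑B = rational-bound c
        -- `shrink` yields half of its argument, so the doubled q gives B δ = q.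
        δ , 0<δ , Bδ = shrink B (q ℚ.+ q) 0<B (ℚ.+-mono-< 0<q 0<q)
    in eventually-map
      (λ M r≤δ → near-weaken
        (begin
          fromℚ (+ 1 ℚ./ suc M) ⊛ c        ≲⟨ *-monoˡ-⊑ (fromℚ-nonneg (1/suc-pos M)) c⊑B ⟩
          fromℚ (+ 1 ℚ./ suc M) ⊛ fromℚ B  ≲⟨ *-monoʳ-⊑ (fromℚ-nonneg 0<B) (fromℚ-mono r≤δ) ⟩
          fromℚ δ ⊛ fromℚ B                ≈⟨ fromℚ-⊛ δ B ⟩
          fromℚ (δ ℚ.* B)                  ≲⟨ fromℚ-mono (ℚ.≤-reflexive
                                                (trans (ℚ.*-comm δ B) (trans Bδ (half-double q)))) ⟩
          fromℚ q                          ∎)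
        (scale (fromℚ (+ 1 ℚ./ suc M)) (fromℚ-nonneg (1/suc-pos M)) (sum-near (suc M))))
      (1/suc-eventually-≤ δ 0<δ)
    where
    half-double : ∀ q → ½ ℚ.* (q ℚ.+ q) ≡ q
    half-double q = trans (ℚ.*-distribˡ-+ ½ q q) (half+half q)

-- Sets depending on finitely many coordinates

private variable A : Set

_Δ_ : Pred (A ^∞) 0ℓ → Pred (A ^∞) 0ℓ → Pred (A ^∞) 0ℓ
P Δ Q = (P ∩ ∁ Q) ∪ (Q ∩ ∁ P)

_∪ᴮ_ : 𝓑 A → 𝓑 A → 𝓑 A
X ∪ᴮ Y = (set X ∪ set Y) ,ᴮ ∪-borel (borel X) (borel Y)

∁ᴮ : 𝓑 A → 𝓑 A
∁ᴮ X = ∁ (set X) ,ᴮ complement (borel X)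

⋃[_]ᴮ_ : ℕ → (ℕ → 𝓑 A) → 𝓑 A
⋃[ n ]ᴮ X = (λ ω → ∃[ i ] (i ℕ.< n × set (X i) ω))
  ,ᴮ respects
    ( (λ (j , x) → toℕ j , toℕ<n j , x)
    , λ {ω} (i , i<n , x) → fromℕ< i<n , subst (λ i → set (X i) ω) (sym (toℕ-fromℕ< i<n)) x )
    (finite-∪-borel n (λ j → borel (X (toℕ j))))

-- One implication suffices, as agreement of coordinates is symmetric.
DependsOn : ℕ → Pred (A ^∞) 0ℓ → Set
DependsOn n S = ∀ {ω ω′} → (∀ i → i ℕ.< n → ω i ≡ ω′ i) → S ω → S ω′

-- With the next two lemmas: appending a letter cuts out the part of `[ w ]` on which coordinate
-- `length w` has that value. Cylinders are refined on the right, so that more initial coordinates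
-- become fixed.
[]-snoc : ∀ (w : List A) {a} ω → [ w ] ω → ω (length w) ≡ a → [ w ∷ʳ a ] ω
[]-snoc []      ω h eq zero    = eq
[]-snoc (b ∷ w) ω h eq zero    = h zero
[]-snoc (b ∷ w) ω h eq (suc i) = []-snoc w (T ω) (h ∘ suc) eq i

snoc-[] : ∀ (w : List A) {a} ω → [ w ∷ʳ a ] ω → [ w ] ω
snoc-[] (b ∷ w) ω h zero    = h zero
snoc-[] (b ∷ w) ω h (suc i) = snoc-[] w (T ω) (h ∘ suc) i

snoc-last : ∀ (w : List A) {a} ω → [ w ∷ʳ a ] ω → ω (length w) ≡ a
snoc-last []      ω h = h zero
snoc-last (b ∷ w) ω h = snoc-last w (T ω) (h ∘ suc)

cylinder-agree : ∀ (w : List A) {ω ω′} → [ w ] ω → [ w ] ω′ → ∀ i → i ℕ.< length w → ω i ≡ ω′ i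
cylinder-agree w {ω} {ω′} h h′ i i<w = subst (λ i → ω i ≡ ω′ i) (toℕ-fromℕ< i<w)
  (trans (h (fromℕ< i<w)) (sym (h′ (fromℕ< i<w))))

cylinder-dependsOn : ∀ (y : List A) → DependsOn (length y) [ y ]
cylinder-dependsOn y agree h i = trans (sym (agree (toℕ i) (toℕ<n i))) (h i)

∁-dependsOn : ∀ {n} {S : Pred (A ^∞) 0ℓ} → DependsOn n S → DependsOn n (∁ S)
∁-dependsOn d agree ¬s s = ¬s (d (λ i i<n → sym (agree i i<n)) s)

∪-dependsOn : ∀ {m n} {S R : Pred (A ^∞) 0ℓ} → DependsOn m S → DependsOn n R →
  DependsOn (m ℕ.⊔ n) (S ∪ R)
∪-dependsOn {m = m} {n} d e agree (inj₁ s) =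
  inj₁ (d (λ i i<m → agree i (ℕ.<-≤-trans i<m (ℕ.m≤m⊔n m n))) s)
∪-dependsOn {m = m} {n} d e agree (inj₂ r) =
  inj₂ (e (λ i i<n → agree i (ℕ.<-≤-trans i<n (ℕ.m≤n⊔m m n))) r)

T⁻¹-dependsOn : ∀ {n} {S : Pred (A ^∞) 0ℓ} → DependsOn n S → DependsOn (suc n) (T ⊢ S)
T⁻¹-dependsOn d agree = d (λ i i<n → agree (suc i) (ℕ.s≤s i<n))

-- `iterate` applies T to its argument first, so T⁻¹ T⁻ᵏ is the order that computes. This lemma
-- supplies the order T⁻ᵏ T⁻¹.
T-iterate : ∀ k (ω : A ^∞) → T (iterate T ω k) ≡ iterate T (T ω) k
T-iterate zero    ω = refl
T-iterate (suc k) ω = T-iterate k (T ω)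

-- A finitely additive set function. In X and in Y separately, both the terms μ(X ∩ T⁻ᵏY) and the
-- limit μ(X) μ(Y) are of this kind, which is how convergence spreads from cylinders.
record Content (F : 𝓑 A → ℝ) : Set₁ where
  field
    F-cong : ∀ X Y → set X ≐ set Y → F X ≃ F Y
    F-∅    : F ∅ᴮ ≃ 0ℝ
    F-⊎    : ∀ X Y → set X ⊥ set Y → F (X ∪ᴮ Y) ≃ F X ⊕ F Y

scaleˡ : ∀ {F : 𝓑 A → ℝ} {c} → 0ℝ ⊑ c → Content F → Content (λ X → c ⊛ F X)
scaleˡ {F = F} {c} 0⊑c φ = record
  { F-cong = λ X Y X≐Y → *-congˡ-≃ 0⊑c (F-cong X Y X≐Y)
  ; F-∅    = ≃-trans (*-congˡ-≃ 0⊑c F-∅) (*-zeroʳ-≃ c)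
  ; F-⊎    = λ X Y X⊥Y → ≃-trans (*-congˡ-≃ 0⊑c (F-⊎ X Y X⊥Y)) (*-distribˡ-≃ c (F X) (F Y))
  }
  where open Content φ

scaleʳ : ∀ {F : 𝓑 A → ℝ} {c} → 0ℝ ⊑ c → Content F → Content (λ X → F X ⊛ c)
scaleʳ {F = F} {c} 0⊑c φ = record
  { F-cong = λ X Y X≐Y → *-congʳ-≃ 0⊑c (F-cong X Y X≐Y)
  ; F-∅    = ≃-trans (*-congʳ-≃ 0⊑c F-∅) (*-zeroˡ-≃ c)
  ; F-⊎    = λ X Y X⊥Y → ≃-trans (*-congʳ-≃ 0⊑c (F-⊎ X Y X⊥Y)) (*-distribʳ-≃ c (F X) (F Y))
  }
  where open Content φ

module _ (lem : ExcludedMiddle 0ℓ) where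

  _∩ᴮ_ : 𝓑 A → 𝓑 A → 𝓑 A
  X ∩ᴮ Y = (set X ∩ set Y) ,ᴮ ∩-borel lem (borel X) (borel Y)

  -- Over a finite alphabet, a set depending on d coordinates is a finite disjoint union of
  -- cylinders. Instead of enumerating all words of length d, the argument splits cylinders one
  -- letter at a time.
  module FinitaryInduction {n} (fin : A ↔ Fin n) (P : 𝓑 A → Set)
    (P-cong : ∀ X Y → set X ≐ set Y → P X → P Y)
    (P-∅    : P ∅ᴮ)
    (P-⊎    : ∀ X Y → set X ⊥ set Y → P X → P Y → P (X ∪ᴮ Y))
    (P-[]   : ∀ y → P [ y ]ᴮ)
    where

    P-finite-⊎ : ∀ k (X : Fin k → 𝓑 A) → (∀ i j → i ≢ j → set (X i) ⊥ set (X j)) →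
      (∀ i → P (X i)) → P ((λ ω → ∃[ i ] set (X i) ω) ,ᴮ finite-∪-borel k (borel ∘ X))
    P-finite-⊎ zero    X X⊥ p = P-cong ∅ᴮ _ ((λ ()) , λ ()) P-∅
    P-finite-⊎ (suc k) X X⊥ p = P-cong (X zero ∪ᴮ rest) _
      ( (λ { (inj₁ x) → zero , x ; (inj₂ (i , x)) → suc i , x })
      , λ { (zero , x) → inj₁ x ; (suc i , x) → inj₂ (i , x) } )
      (P-⊎ (X zero) rest (λ { (x , i , y) → X⊥ zero (suc i) (λ ()) (x , y) }) (p zero)
        (P-finite-⊎ k (X ∘ suc) (λ i j i≢j → X⊥ (suc i) (suc j) (i≢j ∘ suc-injective)) (p ∘ suc)))
      where
      rest : 𝓑 A
      rest = (λ ω → ∃[ i ] set (X (suc i)) ω) ,ᴮ finite-∪-borel k (borel ∘ X ∘ suc)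

    module _ {d} (C : 𝓑 A) (dep : DependsOn d (set C)) where

      letter : Fin n → A
      letter = Inverse.from fin

      letter-injective : ∀ {i j} → letter i ≡ letter j → i ≡ j
      letter-injective {i} {j} eq = trans (sym (Inverse.strictlyInverseˡ fin i))
        (trans (cong (Inverse.to fin) eq) (Inverse.strictlyInverseˡ fin j))

      -- Once w fixes the relevant d coordinates, C contains all of `[ w ]` or none of it, and a
      -- single common point decides which.
      determined : ∀ w → d ℕ.≤ length w → P ([ w ]ᴮ ∩ᴮ C)
      determined w d≤w with lem {∃[ ω ] ([ w ] ω × set C ω)}
      ... | yes (ω , h , c) = P-cong [ w ]ᴮ _
            ( (λ {ω′} h′ → h′ , dep (λ i i<d → cylinder-agree w {ω} {ω′} h h′ i (ℕ.<-≤-trans i<d d≤w)) c)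
            , proj₁ )
            (P-[] w)
      ... | no  none = P-cong ∅ᴮ _ ((λ ()) , λ hc → none (_ , hc)) P-∅

      -- Induction on j, a bound on the number of letters that w still lacks; the one-letter
      -- extensions of w partition `[ w ]`.
      from-cylinder : ∀ j w → d ℕ.≤ length w ℕ.+ j → P ([ w ]ᴮ ∩ᴮ C)
      from-cylinder zero    w d≤ = determined w (subst (d ℕ.≤_) (ℕ.+-identityʳ (length w)) d≤)
      from-cylinder (suc j) w d≤ = P-cong _ _
        ( (λ {ω} (i , h , c) → snoc-[] w ω h , c)
        , λ {ω} (h , c) → Inverse.to fin (ω (length w))
            , []-snoc w ω h (sym (Inverse.strictlyInverseʳ fin (ω (length w)))) , c )
        (P-finite-⊎ n (λ i → [ w ∷ʳ letter i ]ᴮ ∩ᴮ C)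
          (λ { i j i≢j {ω} ((h , _) , (h′ , _)) →
            i≢j (letter-injective (trans (sym (snoc-last w ω h)) (snoc-last w ω h′))) })
          (λ i → from-cylinder j (w ∷ʳ letter i) (subst (d ℕ.≤_) (extend i) d≤)))
        where
        extend : ∀ i → length w ℕ.+ suc j ≡ length (w ∷ʳ letter i) ℕ.+ j
        extend i = trans (sym (ℕ.+-assoc (length w) 1 j)) (cong (ℕ._+ j) (sym (length-++ w)))

      finitary : P C
      finitary = P-cong ([ [] ]ᴮ ∩ᴮ C) C (proj₂ , λ c → (λ ()) , c) (from-cylinder d [] ℕ.≤-refl)

  module _ {n} (fin : A ↔ Fin n) where

    mean-limit-finitary : ∀ {F : ℕ → 𝓑 A → ℝ} {G : 𝓑 A → ℝ} →
      (∀ k → Content (F k)) → Content G →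
      (∀ y → (λ M → mean M (λ k → F k [ y ]ᴮ)) ⇝ G [ y ]ᴮ) →
      ∀ {d} C → DependsOn d (set C) → (λ M → mean M (λ k → F k C)) ⇝ G C
    mean-limit-finitary {F} {G} φ γ cyl C dep = FinitaryInduction.finitary fin
      (λ C → (λ M → mean M (λ k → F k C)) ⇝ G C)
      (λ X Y X≐Y → ⇝-cong (λ M → mean-cong M (λ k → Content.F-cong (φ k) X Y X≐Y))
        (Content.F-cong γ X Y X≐Y))
      (⇝-cong (λ M → ≃-sym (≃-trans (mean-cong M (λ k → Content.F-∅ (φ k))) (mean-const M 0ℝ)))
        (≃-sym (Content.F-∅ γ)) (⇝-eventually-const {λ _ → 0ℝ} (always (λ _ → ≃-refl))))
      (λ X Y X⊥Y p q → ⇝-cong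
        (λ M → ≃-sym (≃-trans (mean-cong M (λ k → Content.F-⊎ (φ k) X Y X⊥Y))
          (mean-⊕ M (λ k → F k X) (λ k → F k Y))))
        (≃-sym (Content.F-⊎ γ X Y X⊥Y)) (⇝-⊕ p q))
      cyl C dep

  -- Approximation of Borel sets by finitary sets

  tail : (ℕ → 𝓑 A) → ℕ → 𝓑 A
  tail X n = ⋃ᴮ X ∩ᴮ ∁ᴮ (⋃[ n ]ᴮ X)

  -- The properties of a measure on which approximation rests; `φ-subadd` with an empty Y contains
  -- monotonicity. The abstraction lets one argument serve both μ and μ + μ ∘ T⁻¹.
  record Submeasure (φ : 𝓑 A → ℝ) : Set₁ where
    field
      φ-∅      : φ ∅ᴮ ⊑ 0ℝ
      φ-subadd : ∀ X Y Z → set Z ⊆ set X ∪ set Y → φ Z ⊑ φ X ⊕ φ Y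
      φ-tail   : ∀ (X : ℕ → 𝓑 A) q → 0ℚ ℚ.< q → Eventually (λ n → φ (tail X n) ⊑ fromℚ q)

    near-cover : ∀ X Y W {e} → set X Δ set Y ⊆ set W → φ W ⊑ e → Near e (φ X) (φ Y)
    near-cover X Y W XΔY⊆W φW⊑e = near
      (⊑-trans (φ-subadd Y W X X⊆Y∪W) (+-monoʳ-⊑ (φ Y) φW⊑e))
      (⊑-trans (φ-subadd X W Y Y⊆X∪W) (+-monoʳ-⊑ (φ X) φW⊑e))
      where
      X⊆Y∪W : set X ⊆ set Y ∪ set W
      X⊆Y∪W {ω} x with lem {set Y ω}
      ... | yes y = inj₁ y
      ... | no ¬y = inj₂ (XΔY⊆W (inj₁ (x , ¬y)))
      Y⊆X∪W : set Y ⊆ set X ∪ set W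
      Y⊆X∪W {ω} y with lem {set X ω}
      ... | yes x = inj₁ x
      ... | no ¬x = inj₂ (XΔY⊆W (inj₂ (y , ¬x)))

  submeasure-+ : ∀ {φ ψ : 𝓑 A → ℝ} → Submeasure φ → Submeasure ψ → Submeasure (λ X → φ X ⊕ ψ X)
  submeasure-+ {φ = φ} {ψ} s t = record
    { φ-∅      = ⊑-trans (+-mono-⊑ S.φ-∅ T′.φ-∅) (≃⇒⊑ (+-identityʳ-≃ 0ℝ))
    ; φ-subadd = λ X Y Z Z⊆ → ⊑-trans (+-mono-⊑ (S.φ-subadd X Y Z Z⊆) (T′.φ-subadd X Y Z Z⊆))
        (≃⇒⊑ (+-interchange-≃ (φ X) (φ Y) (ψ X) (ψ Y)))
    ; φ-tail   = λ X q 0<q → eventually-map₂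
        (λ n a b → ⊑-trans (+-mono-⊑ a b) (≃⇒⊑ (fromℚ-half+half q)))
        (S.φ-tail X (½ ℚ.* q) (half-pos 0<q)) (T′.φ-tail X (½ ℚ.* q) (half-pos 0<q))
    }
    where
    module S = Submeasure s
    module T′ = Submeasure t

  module Approximation {A : Set} {φ : 𝓑 A → ℝ} (s : Submeasure φ) where
    open Submeasure s

    -- Smallness through a Borel cover, as for null sets: P stays a bare predicate, and it is the
    -- cover W that is later pulled back along T.
    Small : ℚ → Pred (A ^∞) 0ℓ → Set₁
    Small q P = Σ[ W ∈ 𝓑 A ] (P ⊆ set W × φ W ⊑ fromℚ q)

    small-∪ : ∀ q {P Q R : Pred (A ^∞) 0ℓ} → R ⊆ P ∪ Q →
      Small (½ ℚ.* q) P → Small (½ ℚ.* q) Q → Small q R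
    small-∪ q {P} {Q} {R} R⊆ (V , P⊆V , V≤) (W , Q⊆W , W≤) = V ∪ᴮ W , cover
      , ⊑-trans (φ-subadd V W (V ∪ᴮ W) id)
          (⊑-trans (+-mono-⊑ V≤ W≤) (≃⇒⊑ (fromℚ-half+half q)))
      where
      cover : R ⊆ set V ∪ set W
      cover r with R⊆ r
      ... | inj₁ p = inj₁ (P⊆V p)
      ... | inj₂ p = inj₂ (Q⊆W p)

    Approximable : Pred (A ^∞) 0ℓ → Set₁
    Approximable P = ∀ q → 0ℚ ℚ.< q →
      Σ[ C ∈ 𝓑 A ] ∃[ d ] (DependsOn d (set C) × Small q (P Δ set C))

    finitary-approximable : ∀ {d P} (C : 𝓑 A) → P ≐ set C → DependsOn d (set C) → Approximable P
    finitary-approximable C (P⊆C , C⊆P) dep q 0<q = C , _ , dep , ∅ᴮ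
      , (λ { (inj₁ (p , ¬c)) → ¬c (P⊆C p) ; (inj₂ (c , ¬p)) → ¬p (C⊆P c) })
      , ⊑-trans φ-∅ (fromℚ-nonneg 0<q)

    ∪-approximable : ∀ {P Q R} → R ≐ P ∪ Q → Approximable P → Approximable Q → Approximable R
    ∪-approximable {P} {Q} {R} (R⊆ , ⊆R) p q ε 0<ε =
      let C , m , dC , sC = p (½ ℚ.* ε) (half-pos 0<ε)
          D , n , dD , sD = q (½ ℚ.* ε) (half-pos 0<ε)
      in C ∪ᴮ D , m ℕ.⊔ n , ∪-dependsOn dC dD , small-∪ ε (split C D) sC sD
      where
      split : ∀ C D → R Δ (set C ∪ set D) ⊆ (P Δ set C) ∪ (Q Δ set D)
      split C D (inj₁ (r , ¬cd)) with R⊆ r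
      ... | inj₁ p = inj₁ (inj₁ (p , ¬cd ∘ inj₁))
      ... | inj₂ q = inj₂ (inj₁ (q , ¬cd ∘ inj₂))
      split C D (inj₂ (inj₁ c , ¬r)) = inj₁ (inj₂ (c , ¬r ∘ ⊆R ∘ inj₁))
      split C D (inj₂ (inj₂ d , ¬r)) = inj₂ (inj₂ (d , ¬r ∘ ⊆R ∘ inj₂))

    partial-union-approximable : ∀ (X : ℕ → 𝓑 A) → (∀ i → Approximable (set (X i))) →
      ∀ n → Approximable (set (⋃[ n ]ᴮ X))
    partial-union-approximable X a zero = finitary-approximable {0} ∅ᴮ
      ((λ ()) , λ ()) (λ _ ())
    partial-union-approximable X a (suc n) =
      ∪-approximable (split , join) (partial-union-approximable X a n) (a n)
      where
      split : set (⋃[ suc n ]ᴮ X) ⊆ set (⋃[ n ]ᴮ X) ∪ set (X n)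
      split {ω} (i , i<1+n , x) with ℕ.m<1+n⇒m<n∨m≡n i<1+n
      ... | inj₁ i<n  = inj₁ (i , i<n , x)
      ... | inj₂ refl = inj₂ x
      join : set (⋃[ n ]ᴮ X) ∪ set (X n) ⊆ set (⋃[ suc n ]ᴮ X)
      join (inj₁ (i , i<n , x)) = i , ℕ.m<n⇒m<1+n i<n , x
      join (inj₂ x)             = n , ℕ.n<1+n n , x

    -- Cut the union where its tail costs at most q / 2, and approximate the remaining finite union
    -- within q / 2.
    union-approximable : ∀ (X : ℕ → 𝓑 A) → (∀ i → Approximable (set (X i))) →
      Approximable (set (⋃ᴮ X))
    union-approximable X a q 0<q =
      let n , tail≤ = φ-tail X (½ ℚ.* q) (half-pos 0<q)
          C , d , dep , sC = partial-union-approximable X a n (½ ℚ.* q) (half-pos 0<q)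
      in C , d , dep
        , small-∪ q (split n C) (tail X n , id , tail≤ n ℕ.≤-refl) sC
      where
      split : ∀ n C → set (⋃ᴮ X) Δ set C ⊆ set (tail X n) ∪ (set (⋃[ n ]ᴮ X) Δ set C)
      split n C {ω} (inj₁ (x , ¬c)) with lem {set (⋃[ n ]ᴮ X) ω}
      ... | yes u = inj₂ (inj₁ (u , ¬c))
      ... | no ¬u = inj₁ (x , ¬u)
      split n C (inj₂ (c , ¬x)) = inj₂ (inj₂ (c , λ (i , _ , x) → ¬x (i , x)))

    -- The approximable sets form a σ-algebra containing the cylinders. Complements keep the same d
    -- and W, since complementing both sets leaves the symmetric difference unchanged.
    borel-approximable : ∀ {P} → Borel P → Approximable P
    borel-approximable (cylinder y) =
      finitary-approximable [ y ]ᴮ (id , id) (cylinder-dependsOn y)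
    borel-approximable (complement {P} b) q 0<q =
      let C , d , dep , W , cover , W≤ = borel-approximable b q 0<q
      in ∁ᴮ C , d , ∁-dependsOn dep , W , cover ∘ flip C , W≤
      where
      flip : ∀ C → ∁ P Δ ∁ (set C) ⊆ P Δ set C
      flip C {ω} (inj₁ (¬p , ¬¬c)) with lem {set C ω}
      ... | yes c = inj₂ (c , ¬p)
      ... | no ¬c = ⊥-elim (¬¬c ¬c)
      flip C {ω} (inj₂ (¬c , ¬¬p)) with lem {P ω}
      ... | yes p = inj₁ (p , ¬c)
      ... | no ¬p = ⊥-elim (¬¬p ¬p)
    borel-approximable (union {X} b) =
      union-approximable (λ i → X i ,ᴮ b i) (λ i → borel-approximable (b i))
    borel-approximable (respects (P⊆Q , Q⊆P) b) q 0<q =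
      let C , d , dep , W , cover , W≤ = borel-approximable b q 0<q
      in C , d , dep , W
        , (λ { (inj₁ (x , ¬c)) → cover (inj₁ (Q⊆P x , ¬c))
             ; (inj₂ (c , ¬x)) → cover (inj₂ (c , ¬x ∘ P⊆Q)) })
        , W≤

-- Measures

module MeasureProperties (lem : ExcludedMiddle 0ℓ) {A : Set} (m : FiniteMeasure A) where
  open FiniteMeasure m

  infixr 7 _∩′_
  _∩′_ : 𝓑 A → 𝓑 A → 𝓑 A
  _∩′_ = _∩ᴮ_ lem

  μ-cong-≃ : ∀ X Y → set X ≐ set Y → μ X ≃ μ Y
  μ-cong-≃ X Y X≐Y = ≈⇒≃ (μ-cong {X} {Y} X≐Y)

  0⊑μ : ∀ X → 0ℝ ⊑ μ X
  0⊑μ X = ⊑-intro (μ-nonneg X)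

  μ-∅-≃ : μ ∅ᴮ ≃ 0ℝ
  μ-∅-≃ = ≈⇒≃ μ-∅

  μ-additive-⇝ : ∀ (X : ℕ → 𝓑 A) → (∀ i j → i ≢ j → set (X i) ⊥ set (X j)) →
    (λ n → sum n (μ ∘ X)) ⇝ μ (⋃ᴮ X)
  μ-additive-⇝ X X⊥ = ⇝-cong
    (λ n → subst (∑[k< n ] (μ ∘ X) ≃_) (∑≡sum n (μ ∘ X)) ≃-refl) ≃-refl
    (⟶⇒⇝ (μ-additive X X⊥))

  -- Countable additivity for the sequence X, Y, ∅, ∅, ..., whose partial sums are constant from the
  -- second on.
  μ-⊎ : ∀ X Y Z → set X ⊥ set Y → set Z ≐ set X ∪ set Y → μ Z ≃ μ X ⊕ μ Y
  μ-⊎ X Y Z X⊥Y (Z⊆ , ⊆Z) = ≃-trans (μ-cong-≃ Z (⋃ᴮ s) (to , from))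
    (⇝-unique (μ-additive-⇝ s s⊥) (⇝-eventually-const (2 , eventually-sum)))
    where
    s : ℕ → 𝓑 A
    s zero          = X
    s (suc zero)    = Y
    s (suc (suc _)) = ∅ᴮ
    s⊥ : ∀ i j → i ≢ j → set (s i) ⊥ set (s j)
    s⊥ zero          zero          i≢j = ⊥-elim (i≢j refl)
    s⊥ zero          (suc zero)    i≢j = X⊥Y
    s⊥ (suc zero)    zero          i≢j = λ (y , x) → X⊥Y (x , y)
    s⊥ (suc zero)    (suc zero)    i≢j = ⊥-elim (i≢j refl)
    s⊥ (suc (suc _)) _             i≢j = λ ()
    s⊥ zero          (suc (suc _)) i≢j = λ ()
    s⊥ (suc zero)    (suc (suc _)) i≢j = λ ()
    to : set Z ⊆ set (⋃ᴮ s)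
    to z with Z⊆ z
    ... | inj₁ x = 0 , x
    ... | inj₂ y = 1 , y
    from : set (⋃ᴮ s) ⊆ set Z
    from (zero     , x) = ⊆Z (inj₁ x)
    from (suc zero , y) = ⊆Z (inj₂ y)
    eventually-sum : ∀ n → 2 ℕ.≤ n → sum n (μ ∘ s) ≃ μ X ⊕ μ Y
    eventually-sum (suc zero) (ℕ.s≤s ())
    eventually-sum (suc (suc zero)) _ =
      +-cong-≃ (≃-trans (+-comm-≃ 0ℝ (μ X)) (+-identityʳ-≃ (μ X))) ≃-refl
    eventually-sum (suc (suc (suc n))) _ = ≃-trans
      (+-cong-≃ (eventually-sum (suc (suc n)) (ℕ.s≤s (ℕ.s≤s ℕ.z≤n))) μ-∅-≃)
      (+-identityʳ-≃ (μ X ⊕ μ Y))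

  μ-content : Content μ
  μ-content = record
    { F-cong = μ-cong-≃
    ; F-∅    = μ-∅-≃
    ; F-⊎    = λ X Y X⊥Y → μ-⊎ X Y (X ∪ᴮ Y) X⊥Y (id , id)
    }

  μ-mono : ∀ X Y → set X ⊆ set Y → μ X ⊑ μ Y
  μ-mono X Y X⊆Y = ⊑-trans (x⊑x+y (μ X) (0⊑μ (Y ∩′ ∁ᴮ X)))
    (≃⇒⊒ (μ-⊎ X (Y ∩′ ∁ᴮ X) Y (λ (x , _ , ¬x) → ¬x x) (split , join)))
    where
    split : set Y ⊆ set X ∪ (set Y ∩ ∁ (set X))
    split {ω} y with lem {set X ω}
    ... | yes x = inj₁ x
    ... | no ¬x = inj₂ (y , ¬x)
    join : set X ∪ (set Y ∩ ∁ (set X)) ⊆ set Y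
    join (inj₁ x)       = X⊆Y x
    join (inj₂ (y , _)) = y

  μ-subadd : ∀ X Y Z → set Z ⊆ set X ∪ set Y → μ Z ⊑ μ X ⊕ μ Y
  μ-subadd X Y Z Z⊆ = begin
    μ Z                    ≲⟨ μ-mono Z (X ∪ᴮ (Y ∩′ ∁ᴮ X)) split ⟩
    μ (X ∪ᴮ (Y ∩′ ∁ᴮ X))   ≈⟨ μ-⊎ X (Y ∩′ ∁ᴮ X) (X ∪ᴮ (Y ∩′ ∁ᴮ X)) (λ (x , _ , ¬x) → ¬x x)
                                (id , id) ⟩
    μ X ⊕ μ (Y ∩′ ∁ᴮ X)    ≲⟨ +-monoʳ-⊑ (μ X) (μ-mono (Y ∩′ ∁ᴮ X) Y proj₁) ⟩
    μ X ⊕ μ Y              ∎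
    where
    split : set Z ⊆ set X ∪ (set Y ∩ ∁ (set X))
    split {ω} z with lem {set X ω} | Z⊆ z
    ... | yes x | _      = inj₁ x
    ... | no ¬x | inj₁ x = ⊥-elim (¬x x)
    ... | no ¬x | inj₂ y = inj₂ (y , ¬x)

  -- Make the sets disjoint: `Z i` holds the points whose least index is i. The partial sums of
  -- their measures are the measures of the partial unions, and the remainder of this convergent
  -- series is the measure of the tail.
  μ-tail : ∀ (X : ℕ → 𝓑 A) q → 0ℚ ℚ.< q → Eventually (λ n → μ (tail lem X n) ⊑ fromℚ q)
  μ-tail X q 0<q = eventually-map
    (λ n near-q → +-cancelˡ-⊑ (μ (⋃[ n ]ᴮ X)) (begin
      μ (⋃[ n ]ᴮ X) ⊕ μ (tail lem X n)  ≈⟨ μ-⊎ (⋃[ n ]ᴮ X) (tail lem X n) (⋃ᴮ X)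
                                              (λ (u , _ , ¬u) → ¬u u) (split n , join n) ⟨
      μ (⋃ᴮ X)                          ≈⟨ μ-cong-≃ (⋃ᴮ X) (⋃ᴮ Z) (first , λ (i , x , _) → i , x) ⟩
      μ (⋃ᴮ Z)                          ≲⟨ Near.lower near-q ⟩
      sum n (μ ∘ Z) ⊕ fromℚ q           ≲⟨ +-monoˡ-⊑ (fromℚ q) (≃⇒⊑ (sum-Z n)) ⟩
      μ (⋃[ n ]ᴮ X) ⊕ fromℚ q           ∎))
    (_⇝_.eventually-near (μ-additive-⇝ Z Z⊥) q 0<q)
    where
    Z : ℕ → 𝓑 A
    Z i = X i ∩′ ∁ᴮ (⋃[ i ]ᴮ X)
    Z⊥ : ∀ i j → i ≢ j → set (Z i) ⊥ set (Z j)
    Z⊥ i j i≢j ((x , ¬u) , (y , ¬v)) with ℕ.<-cmp i j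
    ... | tri< i<j _ _ = ¬v (i , i<j , x)
    ... | tri≈ _ i≡j _ = i≢j i≡j
    ... | tri> _ _ j<i = ¬u (j , j<i , y)
    least : ∀ n {ω} → set (⋃[ n ]ᴮ X) ω → set (⋃ᴮ Z) ω
    least (suc n) {ω} (i , i<1+n , x) with lem {set (⋃[ n ]ᴮ X) ω}
    ... | yes u = least n u
    ... | no ¬u = i , x , λ (j , j<i , y) → ¬u (j , ℕ.<-≤-trans j<i (ℕ.s≤s⁻¹ i<1+n) , y)
    first : set (⋃ᴮ X) ⊆ set (⋃ᴮ Z)
    first (i , x) = least (suc i) (i , ℕ.n<1+n i , x)
    split : ∀ n → set (⋃ᴮ X) ⊆ set (⋃[ n ]ᴮ X) ∪ set (tail lem X n)
    split n {ω} x with lem {set (⋃[ n ]ᴮ X) ω}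
    ... | yes u = inj₁ u
    ... | no ¬u = inj₂ (x , ¬u)
    join : ∀ n → set (⋃[ n ]ᴮ X) ∪ set (tail lem X n) ⊆ set (⋃ᴮ X)
    join n (inj₁ (i , _ , x)) = i , x
    join n (inj₂ (x , _))     = x
    split-suc : ∀ n → set (⋃[ suc n ]ᴮ X) ⊆ set (⋃[ n ]ᴮ X) ∪ set (Z n)
    split-suc n {ω} (i , i<1+n , x) with lem {set (⋃[ n ]ᴮ X) ω} | ℕ.m<1+n⇒m<n∨m≡n i<1+n
    ... | yes u | _         = inj₁ u
    ... | no ¬u | inj₁ i<n  = inj₁ (i , i<n , x)
    ... | no ¬u | inj₂ refl = inj₂ (x , ¬u)
    join-suc : ∀ n → set (⋃[ n ]ᴮ X) ∪ set (Z n) ⊆ set (⋃[ suc n ]ᴮ X)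
    join-suc n (inj₁ (i , i<n , x)) = i , ℕ.m<n⇒m<1+n i<n , x
    join-suc n (inj₂ (x , _))       = n , ℕ.n<1+n n , x
    sum-Z : ∀ n → sum n (μ ∘ Z) ≃ μ (⋃[ n ]ᴮ X)
    sum-Z zero    = ≃-sym (≃-trans (μ-cong-≃ (⋃[ 0 ]ᴮ X) ∅ᴮ ((λ ()) , λ ())) μ-∅-≃)
    sum-Z (suc n) = ≃-trans (+-cong-≃ (sum-Z n) ≃-refl)
      (≃-sym (μ-⊎ (⋃[ n ]ᴮ X) (Z n) (⋃[ suc n ]ᴮ X) (λ (u , _ , ¬u) → ¬u u)
        (split-suc n , join-suc n)))

  μ-submeasure : Submeasure lem μ
  μ-submeasure = record { φ-∅ = ≃⇒⊑ μ-∅-≃ ; φ-subadd = μ-subadd ; φ-tail = μ-tail }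

-- From cylinders to all Borel sets

module Mixing (lem : ExcludedMiddle 0ℓ) {A : Set} {n : ℕ} (fin : A ↔ Fin n) (m : FiniteMeasure A)
  (cylinder-mixing : (x y : List A) → MeanMixing lem fin m [ x ]ᴮ [ y ]ᴮ) where

  open FiniteMeasure m
  open MeasureProperties lem m
  open Submeasure μ-submeasure using (near-cover)

  T⁻¹ᴮ : 𝓑 A → 𝓑 A
  T⁻¹ᴮ X = (T ⊢ set X) ,ᴮ T⁻¹-borel fin (borel X)

  T⁻ᵏᴮ : ℕ → 𝓑 A → 𝓑 A
  T⁻ᵏᴮ k X = ((λ ω → iterate T ω k) ⊢ set X) ,ᴮ T⁻ᵏ-borel fin k (borel X)

  meet : ℕ → 𝓑 A → 𝓑 A → 𝓑 A
  meet k X Y = _∩T⁻[_]_ lem fin X k Y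

  Mixes : 𝓑 A → 𝓑 A → Set
  Mixes X Y = (λ M → mean M (λ k → μ (meet k X Y))) ⇝ μ X ⊛ μ Y

  meet-contentʳ : ∀ X k → Content (λ Y → μ (meet k X Y))
  meet-contentʳ X k = record
    { F-cong = λ Y Z (f , g) → μ-cong-≃ (meet k X Y) (meet k X Z)
        ((λ (x , y) → x , f y) , λ (x , z) → x , g z)
    ; F-∅    = ≃-trans (μ-cong-≃ (meet k X ∅ᴮ) ∅ᴮ ((λ ()) , λ ())) μ-∅-≃
    ; F-⊎    = λ Y Z Y⊥Z → μ-⊎ (meet k X Y) (meet k X Z) (meet k X (Y ∪ᴮ Z))
        (λ ((_ , y) , (_ , z)) → Y⊥Z (y , z))
        ( (λ { (x , inj₁ y) → inj₁ (x , y) ; (x , inj₂ z) → inj₂ (x , z) })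
        , λ { (inj₁ (x , y)) → x , inj₁ y ; (inj₂ (x , z)) → x , inj₂ z } )
    }

  meet-contentˡ : ∀ Y k → Content (λ X → μ (meet k X Y))
  meet-contentˡ Y k = record
    { F-cong = λ X Z (f , g) → μ-cong-≃ (meet k X Y) (meet k Z Y)
        ((λ (x , y) → f x , y) , λ (z , y) → g z , y)
    ; F-∅    = ≃-trans (μ-cong-≃ (meet k ∅ᴮ Y) ∅ᴮ ((λ ()) , λ ())) μ-∅-≃
    ; F-⊎    = λ X Z X⊥Z → μ-⊎ (meet k X Y) (meet k Z Y) (meet k (X ∪ᴮ Z) Y)
        (λ ((x , _) , (z , _)) → X⊥Z (x , z))
        ( (λ { (inj₁ x , y) → inj₁ (x , y) ; (inj₂ z , y) → inj₂ (z , y) })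
        , λ { (inj₁ (x , y)) → inj₁ x , y ; (inj₂ (z , y)) → inj₂ z , y } )
    }

  -- One argument at a time: for a fixed cylinder on the left the right argument is extended to D,
  -- and then, with D fixed, the left one to C.
  finitary-mixes : ∀ {c d} C D → DependsOn c (set C) → DependsOn d (set D) → Mixes C D
  finitary-mixes C D depC depD = mean-limit-finitary lem fin
    (meet-contentˡ D) (scaleʳ (0⊑μ D) μ-content)
    (λ x → mean-limit-finitary lem fin (meet-contentʳ [ x ]ᴮ) (scaleˡ (0⊑μ [ x ]ᴮ) μ-content)
      (λ y → ⟶ᴬ⇒⇝ (cylinder-mixing x y)) D depD)
    C depC

  μ⊑mass : ∀ X → μ X ⊑ μ [ [] ]ᴮ
  μ⊑mass X = μ-mono X [ [] ]ᴮ (λ _ ())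

  -- The averages of μ(T⁻ᵏ C) and of μ(T⁻ᵏ⁻¹ C) have the same limit.
  finitary-invariant : ∀ {d} C → DependsOn d (set C) → μ (T⁻¹ᴮ C) ≃ μ C
  finitary-invariant C dep =
    *-cancel-below (0⊑μ C) (μ⊑mass (T⁻¹ᴮ C)) (≃⇒⊑ limits-agree)
    & *-cancel-below (0⊑μ (T⁻¹ᴮ C)) (μ⊑mass C) (≃⇒⊒ limits-agree)
    where
    Ω = [ [] ]ᴮ
    f : ℕ → ℝ
    f k = μ (meet k Ω C)
    limits-agree : μ Ω ⊛ μ (T⁻¹ᴮ C) ≃ μ Ω ⊛ μ C
    limits-agree = ⇝-unique
      (⇝-cong (λ M → mean-cong M (λ k → μ-cong-≃ (meet k Ω (T⁻¹ᴮ C)) (meet (suc k) Ω C)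
          ( (λ {ω} (_ , c) → (λ ()) , subst (set C) (T-iterate k ω) c)
          , λ {ω} (_ , c) → (λ ()) , subst (set C) (sym (T-iterate k ω)) c )))
        ≃-refl (finitary-mixes Ω (T⁻¹ᴮ C) (cylinder-dependsOn []) (T⁻¹-dependsOn dep)))
      (⇝-mean-suc {f} (λ k → 0⊑μ (meet k Ω C)) (λ k → μ⊑mass (meet k Ω C))
        (finitary-mixes Ω C (cylinder-dependsOn []) dep))

  -- Preimages commute with unions and complements, so each property is that of μ for the preimages.
  T⁻¹-submeasure : Submeasure lem (μ ∘ T⁻¹ᴮ)
  T⁻¹-submeasure = record
    { φ-∅      = ⊑-trans (μ-mono (T⁻¹ᴮ ∅ᴮ) ∅ᴮ (λ ())) (≃⇒⊑ μ-∅-≃)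
    ; φ-subadd = λ X Y Z Z⊆ → μ-subadd (T⁻¹ᴮ X) (T⁻¹ᴮ Y) (T⁻¹ᴮ Z) Z⊆
    ; φ-tail   = λ X q 0<q → eventually-map
        (λ k → ⊑-trans (μ-mono (T⁻¹ᴮ (tail lem X k)) (tail lem (T⁻¹ᴮ ∘ X) k) id))
        (μ-tail (T⁻¹ᴮ ∘ X) q 0<q)
    }

  -- Approximating with respect to μ + μ ∘ T⁻¹ makes C close to Y and T⁻¹ C
  -- close to T⁻¹ Y simultaneously.
  invariant : ∀ Y → μ (T⁻¹ᴮ Y) ≃ μ Y
  invariant Y = ⊑-closed (λ q 0<q → Near.upper (close q 0<q))
    & ⊑-closed (λ q 0<q → Near.lower (close q 0<q))
    where
    open Approximation lem (submeasure-+ lem μ-submeasure T⁻¹-submeasure)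
    close : ∀ q → 0ℚ ℚ.< q → Near (fromℚ q) (μ (T⁻¹ᴮ Y)) (μ Y)
    close q 0<q =
      let C , d , dep , W , cover , W≤ = borel-approximable (borel Y) (½ ℚ.* q) (half-pos 0<q)
          μW≤ = ⊑-trans (x⊑x+y (μ W) (0⊑μ (T⁻¹ᴮ W))) W≤
          μT⁻¹W≤ = ⊑-trans (x⊑x+y (μ (T⁻¹ᴮ W)) (0⊑μ W))
                     (⊑-trans (≃⇒⊑ (+-comm-≃ (μ (T⁻¹ᴮ W)) (μ W))) W≤)
      in near-half-trans q
        -- The same `cover`, read at T ω, shows that T⁻¹W covers the difference of T⁻¹Y and T⁻¹C.
        (near-cover (T⁻¹ᴮ Y) (T⁻¹ᴮ C) (T⁻¹ᴮ W) cover μT⁻¹W≤)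
        (near-cong (≃-sym (finitary-invariant C dep)) ≃-refl
          (near-sym (near-cover Y C W cover μW≤)))

  invariantᵏ : ∀ k Y → μ (T⁻ᵏᴮ k Y) ≃ μ Y
  invariantᵏ zero    Y = μ-cong-≃ (T⁻ᵏᴮ 0 Y) Y (id , id)
  invariantᵏ (suc k) Y = ≃-trans (invariant (T⁻ᵏᴮ k Y)) (invariantᵏ k Y)

  -- The two intersections differ only inside V ∪ T⁻ᵏW, and invariance gives T⁻ᵏW the measure of W,
  -- which removes k from the bound.
  meet-near : ∀ k {e} X X′ Y Y′ V W → set X Δ set X′ ⊆ set V → set Y Δ set Y′ ⊆ set W →
    μ V ⊑ e → μ W ⊑ e → Near (e ⊕ e) (μ (meet k X Y)) (μ (meet k X′ Y′))
  meet-near k {e} X X′ Y Y′ V W cV cW V≤ W≤ =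
    near-cover (meet k X Y) (meet k X′ Y′) (V ∪ᴮ T⁻ᵏᴮ k W) cover
      (⊑-trans (μ-subadd V (T⁻ᵏᴮ k W) (V ∪ᴮ T⁻ᵏᴮ k W) id)
        (+-mono-⊑ V≤ (⊑-trans (≃⇒⊑ (invariantᵏ k W)) W≤)))
    where
    cover : set (meet k X Y) Δ set (meet k X′ Y′) ⊆ set V ∪ set (T⁻ᵏᴮ k W)
    cover {ω} (inj₁ ((x , y) , ¬x′y′)) with lem {set X′ ω}
    ... | yes x′ = inj₂ (cW (inj₁ (y , λ y′ → ¬x′y′ (x′ , y′))))
    ... | no ¬x′ = inj₁ (cV (inj₁ (x , ¬x′)))
    cover {ω} (inj₂ ((x′ , y′) , ¬xy)) with lem {set X ω}
    ... | yes x = inj₂ (cW (inj₂ (y′ , λ y → ¬xy (x , y))))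
    ... | no ¬x = inj₁ (cV (inj₂ (x′ , ¬x)))

  mixes : ∀ X Y → Mixes X Y
  mixes X Y = ⇝-approx approximation
    where
    open Approximation lem μ-submeasure
    approximation : ∀ q → 0ℚ ℚ.< q → Σ[ g ∈ (ℕ → ℝ) ] ∃[ ℓ ]
      (g ⇝ ℓ × (∀ M → Near (fromℚ q) (mean M (λ k → μ (meet k X Y))) (g M))
        × Near (fromℚ q) ℓ (μ X ⊛ μ Y))
    approximation q 0<q =
      let B₀ , 0<B₀ , mass≤B₀ = rational-bound (μ [ [] ]ᴮ)
          -- One δ with B δ = q / 2 serves two purposes: B ≥ 1 gives δ + δ ≤ q for the terms of the
          -- average, and B above the total mass gives the error δ B + δ B = q for the product of
          -- the measures.
          B = 1ℚ ℚ.+ B₀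
          1≤B = ℚ.<⇒≤ (p<p+ε 1ℚ 0<B₀)
          0<B = ℚ.<-≤-trans (ℚ.positive⁻¹ 1ℚ) 1≤B
          δ , 0<δ , Bδ = shrink B q 0<B 0<q
          δ≤½q = subst (ℚ._≤ ½ ℚ.* q) (ℚ.*-identityˡ δ) (subst (1ℚ ℚ.* δ ℚ.≤_) Bδ
                   (ℚ.*-monoʳ-≤-nonNeg δ {{ℚ.nonNegative (ℚ.<⇒≤ 0<δ)}} 1≤B))
          μ≤B = λ Z → ⊑-trans (μ⊑mass Z) (⊑-trans mass≤B₀ (fromℚ-mono
                  (subst (ℚ._≤ B) (ℚ.+-identityˡ B₀)
                    (ℚ.+-monoˡ-≤ B₀ (ℚ.<⇒≤ (ℚ.positive⁻¹ 1ℚ))))))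
          δB = ⊑-trans (≃⇒⊑ (fromℚ-⊛ δ B))
                 (fromℚ-mono (ℚ.≤-reflexive (trans (ℚ.*-comm δ B) Bδ)))
          C , c , depC , V , coverV , V≤ = borel-approximable (borel X) δ 0<δ
          D , d , depD , W , coverW , W≤ = borel-approximable (borel Y) δ 0<δ
          XC = near-cover X C V coverV V≤
          YD = near-cover Y D W coverW W≤
          add = ≃⇒⊑ (fromℚ-half+half q)
      in _ , _ , finitary-mixes C D depC depD
        , (λ M → mean-near M (λ k → near-weaken
            (⊑-trans (+-mono-⊑ (fromℚ-mono δ≤½q) (fromℚ-mono δ≤½q)) add)
            (meet-near k X C Y D V W coverV coverW V≤ W≤)))
        , near-weaken (⊑-trans (+-mono-⊑ δB δB) add) (near
            (⊛-near (fromℚ-nonneg 0<δ) (0⊑μ X) (0⊑μ D) (μ≤B X) (μ≤B D) (Near.lower XC) (Near.lower YD))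
            (⊛-near (fromℚ-nonneg 0<δ) (0⊑μ C) (0⊑μ Y) (μ≤B C) (μ≤B Y) (Near.upper XC) (Near.upper YD)))

theorem9p1 : (lem : ExcludedMiddle 0ℓ) {A : Set} {n : ℕ} (fin : A ↔ Fin n) (m : FiniteMeasure A) →
    ((X Y : 𝓑 A) → MeanMixing lem fin m X Y)
    ⇔ ((x y : List A) → MeanMixing lem fin m [ x ]ᴮ [ y ]ᴮ)
theorem9p1 lem fin m = mk⇔
  (λ mixing x y → mixing [ x ]ᴮ [ y ]ᴮ)
  (λ cylinder-mixing X Y → ⇝⇒⟶ᴬ (Mixing.mixes lem fin m cylinder-mixing X Y))
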